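{- Let $a\ge -1$ be an integer and let $\rho'$ be the root of the polynomial $x^3-ax^2-(a+3)x-1$ satisfying $-2<\rho'<-1$. Then the (inhomogeneous) Jacobi--Perron expansion of the vector $(-\rho',\rho'^2)$ is periodic.
   Context: The polynomial $x^3-ax^2-(a+3)x-1$ (defining Shanks' simplest cubic fields) has three real roots $\rho>a+1$, $-2<\rho'<-1$, $-1<\rho''<0$. The inhomogeneous Jacobi--Perron expansion (iJPA expansion) of $\boldsymbol{\alpha}^{(0)}=(\alpha_1^{(0)},\alpha_2^{(0)})\in\mathbb{R}^2$ is the sequence $\boldsymbol{\alpha}^{(k)}$, $k\ge 0$, defined by $$\boldsymbol{\alpha}^{(k+1)}=\left(\frac{\alpha_2^{(k)}-a_2^{(k)}}{\alpha_1^{(k)}-a_1^{(k)}},\ \frac{1}{\alpha_1^{(k)}-a_1^{(k)}}\right),\qquad a_i^{(k)}=\lfloor\alpha_i^{(k)}\rfloor,\ \alpha_1^{(k)}\neq a_1^{(k)}.$$ It is periodic if there are integers $l_0\ge 0$, $l_1\ge 1$ with $\boldsymbol{\alpha}^{(k+l_1)}=\boldsymbol{\alpha}^{(k)}$ for all $k\ge l_0$. -}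

module Defs where

open import Data.Integer.Base as ℤ using (ℤ; +_)
open import Data.Nat.Base as ℕ using (ℕ; zero; suc; _⊔_)
import Data.Nat.Properties as ℕ
open import Data.Product using (_×_; _,_; proj₁; proj₂; ∃-syntax; Σ-syntax)
open import Data.Rational.Base as ℚ using (ℚ; 0ℚ; 1ℚ; ½; ∣_∣)
import Data.Rational.Properties as ℚ
open import Data.Rational.Solver using (module +-*-Solver)
open import Data.Sum using (_⊎_; inj₁; inj₂)
open import Relation.Binary.PropositionalEquality using (_≡_; refl; sym; trans; cong; cong₂; subst)
open import Relation.Nullary using (¬_)

------------------------------------------------------------------------
-- The real numbers: Cauchy sequences of rationals, compared by the
-- equivalence _≃_ "the difference tends to 0".

CauchySequence : (ℕ → ℚ) → Set
CauchySequence s = ∀ ε → 0ℚ ℚ.< ε →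
  ∃[ N ] (∀ m n → N ℕ.≤ m → N ℕ.≤ n → ∣ s m ℚ.- s n ∣ ℚ.< ε)

record ℝ : Set where
  constructor mkℝ
  field
    seq    : ℕ → ℚ
    cauchy : CauchySequence seq

open ℝ public

infix 4 _≃_ _<_ _≤_ _#_

record _≃_ (x y : ℝ) : Set where
  constructor mk≃
  field
    close : ∀ ε → 0ℚ ℚ.< ε →
      ∃[ N ] (∀ n → N ℕ.≤ n → ∣ seq x n ℚ.- seq y n ∣ ℚ.< ε)

record _<_ (x y : ℝ) : Set where
  constructor mk<
  field
    gap        : ℚ
    gap-pos    : 0ℚ ℚ.< gap
    from       : ℕ
    separation : ∀ n → from ℕ.≤ n → seq x n ℚ.+ gap ℚ.≤ seq y n

_≤_ : ℝ → ℝ → Set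
x ≤ y = ¬ (y < x)

-- Apartness, the constructive form of x ≠ y that permits dividing by x - y.
_#_ : ℝ → ℝ → Set
x # y = x < y ⊎ y < x

private
  half-pos : ∀ {ε} → 0ℚ ℚ.< ε → 0ℚ ℚ.< ½ ℚ.* ε
  half-pos {ε} 0<ε = subst (ℚ._< ½ ℚ.* ε) (ℚ.*-zeroʳ ½) (ℚ.*-monoʳ-<-pos ½ 0<ε)

  halves : ∀ ε → ½ ℚ.* ε ℚ.+ ½ ℚ.* ε ≡ ε
  halves ε = trans (sym (ℚ.*-distribʳ-+ ε ½ ½)) (ℚ.*-identityˡ ε)

  *-pos : ∀ {p q} → 0ℚ ℚ.< p → 0ℚ ℚ.< q → 0ℚ ℚ.< p ℚ.* q
  *-pos {p} {q} 0<p 0<q =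
    subst (ℚ._< p ℚ.* q) (ℚ.*-zeroʳ p) (ℚ.*-monoʳ-<-pos p {{ℚ.positive 0<p}} 0<q)

  *-mono-abs : ∀ {p q b c} → ∣ p ∣ ℚ.≤ b → 0ℚ ℚ.< b → ∣ q ∣ ℚ.< c → ∣ p ℚ.* q ∣ ℚ.< b ℚ.* c
  *-mono-abs {p} {q} {b} {c} p≤b 0<b q<c = begin-strict
    ∣ p ℚ.* q ∣      ≡⟨ ℚ.∣p*q∣≡∣p∣*∣q∣ p q ⟩
    ∣ p ∣ ℚ.* ∣ q ∣  ≤⟨ ℚ.*-monoʳ-≤-nonNeg ∣ q ∣ {{ℚ.∣-∣-nonNeg q}} p≤b ⟩
    b ℚ.* ∣ q ∣      <⟨ ℚ.*-monoʳ-<-pos b {{ℚ.positive 0<b}} q<c ⟩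
    b ℚ.* c          ∎
    where open ℚ.≤-Reasoning

  triangle : ∀ {r} p q {ε} → r ≡ p ℚ.+ q →
             ∣ p ∣ ℚ.< ½ ℚ.* ε → ∣ q ∣ ℚ.< ½ ℚ.* ε → ∣ r ∣ ℚ.< ε
  triangle {r} p q {ε} eq p< q< = begin-strict
    ∣ r ∣                    ≡⟨ cong ∣_∣ eq ⟩
    ∣ p ℚ.+ q ∣              ≤⟨ ℚ.∣p+q∣≤∣p∣+∣q∣ p q ⟩
    ∣ p ∣ ℚ.+ ∣ q ∣          <⟨ ℚ.+-mono-< p< q< ⟩
    ½ ℚ.* ε ℚ.+ ½ ℚ.* ε      ≡⟨ halves ε ⟩
    ε                        ∎
    where open ℚ.≤-Reasoning

  share : (D : ℚ) → 0ℚ ℚ.< D → ℚ → ℚ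
  share D 0<D ε = (ℚ.1/ D) {{ℚ.pos⇒nonZero D {{ℚ.positive 0<D}}}} ℚ.* (½ ℚ.* ε)

  share-pos : ∀ D 0<D ε → 0ℚ ℚ.< ε → 0ℚ ℚ.< share D 0<D ε
  share-pos D 0<D ε 0<ε =
    *-pos {1/D} {½ ℚ.* ε} (ℚ.positive⁻¹ 1/D {{ℚ.1/pos⇒pos D {{ℚ.positive 0<D}}}}) (half-pos {ε} 0<ε)
    where
    1/D : ℚ
    1/D = (ℚ.1/ D) {{ℚ.pos⇒nonZero D {{ℚ.positive 0<D}}}}

  *-share : ∀ D 0<D ε → D ℚ.* share D 0<D ε ≡ ½ ℚ.* ε
  *-share D 0<D ε = trans (sym (ℚ.*-assoc D (ℚ.1/ D) (½ ℚ.* ε)))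
    (trans (cong (ℚ._* (½ ℚ.* ε)) (ℚ.*-inverseʳ D)) (ℚ.*-identityˡ (½ ℚ.* ε)))
    where
    instance
      D-nonZero : ℚ.NonZero D
      D-nonZero = ℚ.pos⇒nonZero D {{ℚ.positive 0<D}}

  cancel-middle : ∀ a b → a ≡ (a ℚ.- b) ℚ.+ b
  cancel-middle = solve 2 (λ a b → a := (a :- b) :+ b) refl
    where open +-*-Solver

  neg-swap : ∀ a b → b ℚ.- a ≡ (ℚ.- a) ℚ.- (ℚ.- b)
  neg-swap = solve 2 (λ a b → b :- a := (:- a) :- (:- b)) refl
    where open +-*-Solver

  sum-split : ∀ a b c d → (a ℚ.+ b) ℚ.- (c ℚ.+ d) ≡ (a ℚ.- c) ℚ.+ (b ℚ.- d)
  sum-split = solve 4 (λ a b c d → (a :+ b) :- (c :+ d) := (a :- c) :+ (b :- d)) refl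
    where open +-*-Solver

  product-split : ∀ a b c d → a ℚ.* b ℚ.- c ℚ.* d ≡ a ℚ.* (b ℚ.- d) ℚ.+ d ℚ.* (a ℚ.- c)
  product-split = solve 4 (λ a b c d → a :* b :- c :* d := a :* (b :- d) :+ d :* (a :- c)) refl
    where open +-*-Solver

  product-close : ∀ B C ε a b c d (0<B : 0ℚ ℚ.< B) (0<C : 0ℚ ℚ.< C) →
    ∣ a ∣ ℚ.≤ B → ∣ d ∣ ℚ.≤ C →
    ∣ b ℚ.- d ∣ ℚ.< share B 0<B ε → ∣ a ℚ.- c ∣ ℚ.< share C 0<C ε →
    ∣ a ℚ.* b ℚ.- c ℚ.* d ∣ ℚ.< ε
  product-close B C ε a b c d 0<B 0<C a≤B d≤C b~d a~c =
    triangle (a ℚ.* (b ℚ.- d)) (d ℚ.* (a ℚ.- c)) {ε} (product-split a b c d)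
      (subst (∣ a ℚ.* (b ℚ.- d) ∣ ℚ.<_) (*-share B 0<B ε)
        (*-mono-abs {a} {b ℚ.- d} {B} {share B 0<B ε} a≤B 0<B b~d))
      (subst (∣ d ℚ.* (a ℚ.- c) ∣ ℚ.<_) (*-share C 0<C ε)
        (*-mono-abs {d} {a ℚ.- c} {C} {share C 0<C ε} d≤C 0<C a~c))

  ⊔ˡ : ∀ a b {n} → a ⊔ b ℕ.≤ n → a ℕ.≤ n
  ⊔ˡ a b = ℕ.≤-trans (ℕ.m≤m⊔n a b)

  ⊔ʳ : ∀ a b {n} → a ⊔ b ℕ.≤ n → b ℕ.≤ n
  ⊔ʳ a b = ℕ.≤-trans (ℕ.m≤n⊔m a b)

  bounded : ∀ x → ∃[ B ] (0ℚ ℚ.< B × ∃[ N ] (∀ n → N ℕ.≤ n → ∣ seq x n ∣ ℚ.≤ B))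
  bounded x = B , 0<B , N , bound
    where
    open ℚ.≤-Reasoning

    N : ℕ
    N = proj₁ (cauchy x 1ℚ (ℚ.positive⁻¹ 1ℚ))

    B : ℚ
    B = 1ℚ ℚ.+ ∣ seq x N ∣

    0<B : 0ℚ ℚ.< B
    0<B = ℚ.+-mono-<-≤ (ℚ.positive⁻¹ 1ℚ) (ℚ.0≤∣p∣ (seq x N))

    bound : ∀ n → N ℕ.≤ n → ∣ seq x n ∣ ℚ.≤ B
    bound n N≤n = begin
      ∣ seq x n ∣
        ≡⟨ cong ∣_∣ (cancel-middle (seq x n) (seq x N)) ⟩
      ∣ (seq x n ℚ.- seq x N) ℚ.+ seq x N ∣
        ≤⟨ ℚ.∣p+q∣≤∣p∣+∣q∣ (seq x n ℚ.- seq x N) (seq x N) ⟩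
      ∣ seq x n ℚ.- seq x N ∣ ℚ.+ ∣ seq x N ∣
        ≤⟨ ℚ.+-monoˡ-≤ ∣ seq x N ∣
             (ℚ.<⇒≤ (proj₂ (cauchy x 1ℚ (ℚ.positive⁻¹ 1ℚ)) n N N≤n ℕ.≤-refl)) ⟩
      B ∎

fromℚ : ℚ → ℝ
fromℚ q = mkℝ (λ _ → q) λ ε 0<ε → 0 , λ _ _ _ _ →
  subst (λ d → ∣ d ∣ ℚ.< ε) (sym (ℚ.+-inverseʳ q)) 0<ε

fromℤ : ℤ → ℝ
fromℤ i = fromℚ (i ℚ./ 1)

0ℝ 1ℝ : ℝ
0ℝ = fromℤ (+ 0)
1ℝ = fromℤ (+ 1)

infixl 6 _+_ _-_
infixl 7 _*_
infix  8 -_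
infixr 9 _^_

_+_ : ℝ → ℝ → ℝ
x + y = mkℝ (λ n → seq x n ℚ.+ seq y n) λ ε 0<ε →
  let (M , closeˣ) = cauchy x (½ ℚ.* ε) (half-pos {ε} 0<ε)
      (N , closeʸ) = cauchy y (½ ℚ.* ε) (half-pos {ε} 0<ε)
  in M ⊔ N , λ m n m≥ n≥ →
    triangle (seq x m ℚ.- seq x n) (seq y m ℚ.- seq y n) {ε}
      (sum-split (seq x m) (seq y m) (seq x n) (seq y n))
      (closeˣ m n (⊔ˡ M N m≥) (⊔ˡ M N n≥))
      (closeʸ m n (⊔ʳ M N m≥) (⊔ʳ M N n≥))

-_ : ℝ → ℝ
- x = mkℝ (λ n → ℚ.- seq x n) λ ε 0<ε →
  let (N , close) = cauchy x ε 0<ε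
  in N , λ m n m≥ n≥ →
    subst (λ d → ∣ d ∣ ℚ.< ε) (neg-swap (seq x m) (seq x n)) (close n m n≥ m≥)

_-_ : ℝ → ℝ → ℝ
x - y = x + (- y)

_*_ : ℝ → ℝ → ℝ
x * y = mkℝ (λ n → seq x n ℚ.* seq y n) λ ε 0<ε →
  let (B , 0<B , K , x≤B) = bounded x
      (C , 0<C , L , y≤C) = bounded y
      (M , closeˣ) = cauchy x (share C 0<C ε) (share-pos C 0<C ε 0<ε)
      (N , closeʸ) = cauchy y (share B 0<B ε) (share-pos B 0<B ε 0<ε)
  in (K ⊔ L) ⊔ (M ⊔ N) , λ m n m≥ n≥ →
    let K⊔L≤m = ⊔ˡ (K ⊔ L) (M ⊔ N) m≥
        K⊔L≤n = ⊔ˡ (K ⊔ L) (M ⊔ N) n≥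
        M⊔N≤m = ⊔ʳ (K ⊔ L) (M ⊔ N) m≥
        M⊔N≤n = ⊔ʳ (K ⊔ L) (M ⊔ N) n≥
    in product-close B C ε (seq x m) (seq y m) (seq x n) (seq y n) 0<B 0<C
      (x≤B m (⊔ˡ K L K⊔L≤m)) (y≤C n (⊔ʳ K L K⊔L≤n))
      (closeʸ m n (⊔ʳ M N M⊔N≤m) (⊔ʳ M N M⊔N≤n))
      (closeˣ m n (⊔ˡ M N M⊔N≤m) (⊔ˡ M N M⊔N≤n))

_^_ : ℝ → ℕ → ℝ
x ^ zero  = 1ℝ
x ^ suc n = x * x ^ n

private
  -- Apartness from 0 bounds the terms of the sequence away from 0 eventually.
  away : ∀ x → x # 0ℝ →
         ∃[ δ ] (0ℚ ℚ.< δ × ∃[ N ] (∀ n → N ℕ.≤ n → δ ℚ.≤ ∣ seq x n ∣))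
  away x (inj₁ (mk< δ 0<δ N x+δ≤0)) = δ , 0<δ , N , λ n N≤n →
    below-zero (seq x n) (x+δ≤0 n N≤n)
    where
    open ℚ.≤-Reasoning

    p≤∣p∣ : ∀ p → p ℚ.≤ ∣ p ∣
    p≤∣p∣ p with ℚ.≤-total 0ℚ p
    ... | inj₁ 0≤p = ℚ.≤-reflexive (sym (ℚ.0≤p⇒∣p∣≡p 0≤p))
    ... | inj₂ p≤0 = ℚ.≤-trans p≤0 (ℚ.0≤∣p∣ p)

    below-zero : ∀ p → p ℚ.+ δ ℚ.≤ 0ℚ → δ ℚ.≤ ∣ p ∣
    below-zero p p+δ≤0 = begin
      δ                            ≡⟨ ℚ.+-identityˡ δ ⟨
      0ℚ ℚ.+ δ                     ≡⟨ cong (ℚ._+ δ) (ℚ.+-inverseˡ p) ⟨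
      (ℚ.- p ℚ.+ p) ℚ.+ δ          ≡⟨ ℚ.+-assoc (ℚ.- p) p δ ⟩
      ℚ.- p ℚ.+ (p ℚ.+ δ)          ≤⟨ ℚ.+-monoʳ-≤ (ℚ.- p) p+δ≤0 ⟩
      ℚ.- p ℚ.+ 0ℚ                 ≡⟨ ℚ.+-identityʳ (ℚ.- p) ⟩
      ℚ.- p                        ≤⟨ p≤∣p∣ (ℚ.- p) ⟩
      ∣ ℚ.- p ∣                    ≡⟨ ℚ.∣-p∣≡∣p∣ p ⟩
      ∣ p ∣                        ∎
  away x (inj₂ (mk< δ 0<δ N 0+δ≤x)) = δ , 0<δ , N , λ n N≤n →
    above-zero (seq x n) (0+δ≤x n N≤n)
    where
    above-zero : ∀ p → 0ℚ ℚ.+ δ ℚ.≤ p → δ ℚ.≤ ∣ p ∣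
    above-zero p 0+δ≤p =
      let δ≤p = subst (ℚ._≤ p) (ℚ.+-identityˡ δ) 0+δ≤p
      in subst (δ ℚ.≤_) (sym (ℚ.0≤p⇒∣p∣≡p (ℚ.≤-trans (ℚ.<⇒≤ 0<δ) δ≤p))) δ≤p

  bounded-nonZero : ∀ {δ} p → 0ℚ ℚ.< δ → δ ℚ.≤ ∣ p ∣ → ℚ.NonZero p
  bounded-nonZero p 0<δ δ≤∣p∣ = ℚ.≢-nonZero λ p≡0 →
    ℚ.<-irrefl refl (ℚ.<-≤-trans 0<δ (subst (λ q → _ ℚ.≤ ∣ q ∣) p≡0 δ≤∣p∣))

  cross : ∀ a b u v → (u ℚ.- v) ℚ.* (a ℚ.* b) ≡ (a ℚ.* u) ℚ.* b ℚ.- (b ℚ.* v) ℚ.* a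
  cross = solve 4 (λ a b u v → (u :- v) :* (a :* b) := (a :* u) :* b :- (b :* v) :* a) refl
    where open +-*-Solver

  1/-close : ∀ {δ} ε p q .{{_ : ℚ.NonZero p}} .{{_ : ℚ.NonZero q}} → 0ℚ ℚ.< δ →
             δ ℚ.≤ ∣ p ∣ → δ ℚ.≤ ∣ q ∣ → ∣ q ℚ.- p ∣ ℚ.< ε ℚ.* (δ ℚ.* δ) →
             ∣ ℚ.1/ p ℚ.- ℚ.1/ q ∣ ℚ.< ε
  1/-close {δ} ε p q 0<δ δ≤p δ≤q close =
    ℚ.*-cancelʳ-<-nonNeg (δ ℚ.* δ) {{ℚ.nonNegative (ℚ.<⇒≤ (*-pos {δ} {δ} 0<δ 0<δ))}} (begin-strict
      ∣ d ∣ ℚ.* (δ ℚ.* δ)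
        ≤⟨ ℚ.*-monoˡ-≤-nonNeg ∣ d ∣ {{ℚ.∣-∣-nonNeg d}} δδ≤ ⟩
      ∣ d ∣ ℚ.* (∣ p ∣ ℚ.* ∣ q ∣)
        ≡⟨ cong (∣ d ∣ ℚ.*_) (ℚ.∣p*q∣≡∣p∣*∣q∣ p q) ⟨
      ∣ d ∣ ℚ.* ∣ p ℚ.* q ∣
        ≡⟨ ℚ.∣p*q∣≡∣p∣*∣q∣ d (p ℚ.* q) ⟨
      ∣ d ℚ.* (p ℚ.* q) ∣
        ≡⟨ cong ∣_∣ clear ⟩
      ∣ q ℚ.- p ∣
        <⟨ close ⟩
      ε ℚ.* (δ ℚ.* δ) ∎)
    where
    open ℚ.≤-Reasoning

    d : ℚ
    d = ℚ.1/ p ℚ.- ℚ.1/ q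

    δδ≤ : δ ℚ.* δ ℚ.≤ ∣ p ∣ ℚ.* ∣ q ∣
    δδ≤ = ℚ.≤-trans
      (ℚ.*-monoʳ-≤-nonNeg δ {{ℚ.nonNegative (ℚ.<⇒≤ 0<δ)}} δ≤p)
      (ℚ.*-monoˡ-≤-nonNeg ∣ p ∣ {{ℚ.∣-∣-nonNeg p}} δ≤q)

    clear : d ℚ.* (p ℚ.* q) ≡ q ℚ.- p
    clear = trans (cross p q (ℚ.1/ p) (ℚ.1/ q))
      (cong₂ ℚ._-_
        (trans (cong (ℚ._* q) (ℚ.*-inverseʳ p)) (ℚ.*-identityˡ q))
        (trans (cong (ℚ._* p) (ℚ.*-inverseʳ q)) (ℚ.*-identityˡ p)))

-- The initial terms of the sequence of x, which may vanish, are dropped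
-- before inverting termwise.
inverse : (x : ℝ) → x # 0ℝ → ℝ
inverse x x#0 = mkℝ recip λ ε 0<ε →
  let (M , close) = cauchy x (ε ℚ.* (δ ℚ.* δ)) (*-pos {ε} {δ ℚ.* δ} 0<ε (*-pos {δ} {δ} 0<δ 0<δ))
  in M , λ m n m≥ n≥ →
    1/-close ε (tail m) (tail n) {{tail-nonZero m}} {{tail-nonZero n}} 0<δ
      (δ≤tail m) (δ≤tail n)
      (close (N ℕ.+ n) (N ℕ.+ m)
        (ℕ.≤-trans n≥ (ℕ.m≤n+m n N)) (ℕ.≤-trans m≥ (ℕ.m≤n+m m N)))
  where
  δ : ℚ
  δ = proj₁ (away x x#0)

  0<δ : 0ℚ ℚ.< δ
  0<δ = proj₁ (proj₂ (away x x#0))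

  N : ℕ
  N = proj₁ (proj₂ (proj₂ (away x x#0)))

  tail : ℕ → ℚ
  tail n = seq x (N ℕ.+ n)

  δ≤tail : ∀ n → δ ℚ.≤ ∣ tail n ∣
  δ≤tail n = proj₂ (proj₂ (proj₂ (away x x#0))) (N ℕ.+ n) (ℕ.m≤m+n N n)

  tail-nonZero : ∀ n → ℚ.NonZero (tail n)
  tail-nonZero n = bounded-nonZero (tail n) 0<δ (δ≤tail n)

  recip : ℕ → ℚ
  recip n = (ℚ.1/ tail n) {{tail-nonZero n}}

------------------------------------------------------------------------
-- The inhomogeneous Jacobi–Perron expansion

ℝ² : Set
ℝ² = ℝ × ℝ

infix 4 _≃²_

_≃²_ : ℝ² → ℝ² → Set
(x₁ , x₂) ≃² (y₁ , y₂) = x₁ ≃ y₁ × x₂ ≃ y₂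

-- n = ⌊ x ⌋, as a relation: there is no constructive floor function on ℝ.
_IsFloorOf_ : ℤ → ℝ → Set
n IsFloorOf x = fromℤ n ≤ x × x < fromℤ n + 1ℝ

-- The digits a₁, a₂ are determined by x since an integer part is unique.
IJPAStep : ℝ² → ℝ² → Set
IJPAStep (x₁ , x₂) y =
  ∃[ a₁ ] ∃[ a₂ ] (a₁ IsFloorOf x₁ × a₂ IsFloorOf x₂ ×
    Σ[ x₁#a₁ ∈ (x₁ - fromℤ a₁) # 0ℝ ]
      y ≃² ( (x₂ - fromℤ a₂) * inverse (x₁ - fromℤ a₁) x₁#a₁
           , inverse (x₁ - fromℤ a₁) x₁#a₁ ))

IsIJPAExpansion : ℝ² → (ℕ → ℝ²) → Set
IsIJPAExpansion v α = α 0 ≃² v × (∀ k → IJPAStep (α k) (α (suc k)))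

Periodic : (ℕ → ℝ²) → Set
Periodic α = ∃[ l₀ ] ∃[ l₁ ] (1 ℕ.≤ l₁ × (∀ k → l₀ ℕ.≤ k → α (k ℕ.+ l₁) ≃² α k))

-- An expansion of v is unique up to _≃²_, so this says that the expansion of v
-- never terminates and is periodic.
HasPeriodicIJPAExpansion : ℝ² → Set
HasPeriodicIJPAExpansion v = ∃[ α ] (IsIJPAExpansion v α × Periodic α)

shanks : ℤ → ℝ → ℝ
shanks a x = x ^ 3 - fromℤ a * x ^ 2 - fromℤ (a ℤ.+ + 3) * x - 1ℝ

{-# OPTIONS --safe #-}
-- Put t = -ρ′ - 1, so that 0 < t and t³ + (a + 3) t² + a t = 1.  In homogeneous
-- coordinates α = (u₁ / u₀ , u₂ / u₀) a step with digits d₁, d₂ is the linear map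
-- (u₀ , u₁ , u₂) ↦ (u₁ - d₁ u₀ , u₂ - d₂ u₀ , u₀), so all coordinates stay in
-- ℤ[t], and the digits are correct as soon as certain elements of ℤ[t] are
-- positive.  Since t > 0, an element is positive if some multiple of it by a
-- power of 1 + 1/t has nonnegative coefficients.  For -1 ≤ a ≤ 3 and for both
-- parities of a ≥ 4 the digits are explicit, with coefficients polynomial in a
-- parameter m ≥ 0, so that positivity and the proportionality of two coordinate
-- vectors (which closes the period) are decided on integer coefficients.

module Submission where

open import Algebra.Bundles using (CommutativeRing)
import Algebra.Solver.Ring as RingSolver
open import Algebra.Solver.Ring.AlmostCommutativeRing
  using (fromCommutativeRing; _-Raw-AlmostCommutative⟶_)
open import Algebra.Structures using (IsCommutativeRing)
open import Data.Empty using (⊥)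
open import Data.Fin.Base using (zero; suc)
open import Data.Integer.Base as ℤ using (ℤ; +_; -[1+_])
import Data.Integer.Properties as ℤ
open import Data.Integer.Solver using () renaming (module +-*-Solver to ℤ-Solver)
open import Data.List.Base using (List; []; _∷_; map)
open import Data.List.NonEmpty.Base using (List⁺; _∷_)
open import Data.List.Relation.Unary.All as All using (All; []; _∷_)
open import Data.Maybe.Base using (Maybe; just; nothing)
open import Data.Nat.Base as ℕ using (ℕ; zero; suc; _⊔_)
open import Data.Nat.DivMod using (_divMod_; result)
import Data.Nat.Properties as ℕ
open import Data.Product using (_×_; _,_; proj₁; proj₂; ∃-syntax; Σ-syntax)
open import Data.Rational.Base as ℚ using (ℚ; 0ℚ; 1ℚ; ½; ∣_∣; toℚᵘ)
import Data.Rational.Properties as ℚ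
open import Data.Rational.Solver using (module +-*-Solver)
open import Data.Rational.Unnormalised.Base as ℚᵘ using (mkℚᵘ; *≡*)
import Data.Rational.Unnormalised.Properties as ℚᵘ
open import Data.Sum using (inj₁; inj₂)
open import Level using (0ℓ)
open import Relation.Binary.Construct.Closure.Transitive using (TransClosure; module TransClosure)
open import Relation.Binary.Core using (Rel)
open import Relation.Binary.PropositionalEquality
  using (_≡_; refl; sym; trans; cong; cong₂; subst)
import Relation.Binary.Reasoning.Setoid as SetoidReasoning
open import Relation.Nullary using (¬_; Dec; yes; no)
open import Relation.Nullary.Decidable using (_×-dec_; map′; True; toWitness)

open TransClosure

-- Eventually periodic orbits of a relation

module Orbits {X : Set} (_⟶_ : Rel X 0ℓ) where

  infix 4 _⟶⁺_

  _⟶⁺_ : Rel X 0ℓ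
  _⟶⁺_ = TransClosure _⟶_

  -- Points repeat up to `≡`, since the walk around a cycle revisits the very same points; any
  -- coarser equality has to be absorbed into the last step of the cycle beforehand.
  HasPeriodicOrbit : X → Set
  HasPeriodicOrbit x = Σ[ α ∈ (ℕ → X) ] (α 0 ≡ x × (∀ k → α k ⟶ α (suc k)) ×
    ∃[ l₀ ] ∃[ l₁ ] (1 ℕ.≤ l₁ × (∀ k → l₀ ℕ.≤ k → α (k ℕ.+ l₁) ≡ α k)))

  module _ {x} (cycle : x ⟶⁺ x) where

    -- The walk follows the given path; its last step arrives at x, and from there `cycle` is taken
    -- up again and again.
    orbit : ∀ {y} → ℕ → y ⟶⁺ x → X
    orbit {y} zero    _       = y
    orbit     (suc k) [ _ ]   = orbit k cycle
    orbit     (suc k) (_ ∷ p) = orbit k p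

    orbit-step : ∀ {y} k (p : y ⟶⁺ x) → orbit k p ⟶ orbit (suc k) p
    orbit-step zero    [ y⟶x ]   = y⟶x
    orbit-step zero    (y⟶z ∷ _) = y⟶z
    orbit-step (suc k) [ _ ]      = orbit-step k cycle
    orbit-step (suc k) (_ ∷ p)    = orbit-step k p

    length : ∀ {y} → y ⟶⁺ x → ℕ
    length [ _ ]   = 1
    length (_ ∷ p) = suc (length p)

    1≤length : ∀ {y} (p : y ⟶⁺ x) → 1 ℕ.≤ length p
    1≤length [ _ ]   = ℕ.≤-refl
    1≤length (_ ∷ _) = ℕ.s≤s ℕ.z≤n

    -- Once the path is used up, the walk stands at x with the whole cycle ahead. For the path
    -- `cycle` itself this is periodicity.
    orbit-length : ∀ {y} k (p : y ⟶⁺ x) → orbit (length p ℕ.+ k) p ≡ orbit k cycle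
    orbit-length k [ _ ]   = refl
    orbit-length k (_ ∷ p) = orbit-length k p

    cycle⇒periodic : HasPeriodicOrbit x
    cycle⇒periodic = (λ k → orbit k cycle) , refl , (λ k → orbit-step k cycle)
      , 0 , length cycle , 1≤length cycle , λ k _ →
        trans (cong (λ j → orbit j cycle) (ℕ.+-comm k (length cycle))) (orbit-length k cycle)

  prepend-step : ∀ {x y} → x ⟶ y → HasPeriodicOrbit y → HasPeriodicOrbit x
  prepend-step {x} x⟶y (α , refl , steps , l₀ , l₁ , 1≤l₁ , repeats) =
    -- The added first point delays the periodic part by one index, so index 0 is never asked to
    -- repeat.
    β , refl , β-step , suc l₀ , l₁ , 1≤l₁ , λ { (suc k) (ℕ.s≤s l₀≤k) → repeats k l₀≤k }
    where
    β : ℕ → X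
    β zero    = x
    β (suc k) = α k

    β-step : ∀ k → β k ⟶ β (suc k)
    β-step zero    = x⟶y
    β-step (suc k) = steps k

  prepend-path : ∀ {x y} → x ⟶⁺ y → HasPeriodicOrbit y → HasPeriodicOrbit x
  prepend-path [ x⟶y ]   y-periodic = prepend-step x⟶y y-periodic
  prepend-path (x⟶z ∷ p) y-periodic = prepend-step x⟶z (prepend-path p y-periodic)

-- Polynomials over ℤ

Poly : Set
Poly = List ℤ

infixl 6 _⊕_
infixl 7 _⊗_

_⊕_ : Poly → Poly → Poly
[]      ⊕ q       = q
(a ∷ p) ⊕ []      = a ∷ p
(a ∷ p) ⊕ (b ∷ q) = a ℤ.+ b ∷ p ⊕ q

scale : ℤ → Poly → Poly
scale a = map (a ℤ.*_)

_⊗_ : Poly → Poly → Poly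
[]      ⊗ q = []
(a ∷ p) ⊗ q = scale a q ⊕ (+ 0 ∷ p ⊗ q)

eval : Poly → ℤ → ℤ
eval []      m = + 0
eval (a ∷ p) m = a ℤ.+ m ℤ.* eval p m

eval-⊕ : ∀ p q m → eval (p ⊕ q) m ≡ eval p m ℤ.+ eval q m
eval-⊕ []      q       m = sym (ℤ.+-identityˡ (eval q m))
eval-⊕ (a ∷ p) []      m = sym (ℤ.+-identityʳ (eval (a ∷ p) m))
eval-⊕ (a ∷ p) (b ∷ q) m = trans (cong (λ v → a ℤ.+ b ℤ.+ m ℤ.* v) (eval-⊕ p q m))
  (solve 5 (λ a b m v w → a :+ b :+ m :* (v :+ w) := a :+ m :* v :+ (b :+ m :* w)) refl
    a b m (eval p m) (eval q m))
  where open ℤ-Solver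

eval-scale : ∀ a p m → eval (scale a p) m ≡ a ℤ.* eval p m
eval-scale a []      m = sym (ℤ.*-zeroʳ a)
eval-scale a (b ∷ p) m = trans (cong (λ v → a ℤ.* b ℤ.+ m ℤ.* v) (eval-scale a p m))
  (solve 4 (λ a b m v → a :* b :+ m :* (a :* v) := a :* (b :+ m :* v)) refl a b m (eval p m))
  where open ℤ-Solver

eval-⊗ : ∀ p q m → eval (p ⊗ q) m ≡ eval p m ℤ.* eval q m
eval-⊗ []      q m = refl
eval-⊗ (a ∷ p) q m = trans (eval-⊕ (scale a q) (+ 0 ∷ p ⊗ q) m)
  (trans (cong₂ (λ v w → v ℤ.+ (+ 0 ℤ.+ m ℤ.* w)) (eval-scale a q m) (eval-⊗ p q m))
    (solve 4 (λ a m v w → a :* w :+ (con (+ 0) :+ m :* (v :* w)) := (a :+ m :* v) :* w) refl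
      a m (eval p m) (eval q m)))
  where open ℤ-Solver

-- Coefficient lists are not normalised and may end in zeros, so the zero polynomial is recognised
-- by its entries and not by the empty list.
NonNegCoeffs ZeroCoeffs : Poly → Set
NonNegCoeffs = All (+ 0 ℤ.≤_)
ZeroCoeffs = All (+ 0 ≡_)

-- Strictness is asked of the constant coefficient because the parameter may be 0, where only that
-- coefficient survives.
PosCoeffs : Poly → Set
PosCoeffs []      = ⊥
PosCoeffs (a ∷ p) = + 0 ℤ.< a × NonNegCoeffs p

*-nonNeg : ∀ n {i} → + 0 ℤ.≤ i → + 0 ℤ.≤ + n ℤ.* i
*-nonNeg n {i} 0≤i = subst (ℤ._≤ + n ℤ.* i) (ℤ.*-zeroʳ (+ n)) (ℤ.*-monoˡ-≤-nonNeg (+ n) 0≤i)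

eval-nonNeg : ∀ {p} n → NonNegCoeffs p → + 0 ℤ.≤ eval p (+ n)
eval-nonNeg n []          = ℤ.≤-refl
eval-nonNeg n (0≤a ∷ 0≤p) = ℤ.+-mono-≤ 0≤a (*-nonNeg n (eval-nonNeg n 0≤p))

eval-pos : ∀ p n → PosCoeffs p → + 0 ℤ.< eval p (+ n)
eval-pos (a ∷ p) n (0<a , 0≤p) = ℤ.+-mono-<-≤ 0<a (*-nonNeg n (eval-nonNeg n 0≤p))

eval-zero : ∀ {p} m → ZeroCoeffs p → eval p m ≡ + 0
eval-zero m []           = refl
eval-zero m (refl ∷ p≡0) = trans (ℤ.+-identityˡ _) (trans (cong (m ℤ.*_) (eval-zero m p≡0)) (ℤ.*-zeroʳ m))

-- The order ℤ[m][t]/(t³ + (a + 3) t² + a t - 1)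

-- (c₀ , c₁ , c₂) stands for c₀ t² + c₁ t + c₂.
Element : Set
Element = Poly × Poly × Poly

infixl 6 _⊞_ _⊟_
infixl 7 _·_

_⊞_ : Element → Element → Element
(c₀ , c₁ , c₂) ⊞ (d₀ , d₁ , d₂) = c₀ ⊕ d₀ , c₁ ⊕ d₁ , c₂ ⊕ d₂

_·_ : Poly → Element → Element
p · (c₀ , c₁ , c₂) = p ⊗ c₀ , p ⊗ c₁ , p ⊗ c₂

_⊟_ : Element → Element → Element
c ⊟ d = c ⊞ (-[1+ 0 ] ∷ []) · d

module Order (a : Poly) where

  infixl 7 _⊠_

  -- The product c₀ t³ + c₁ t² + c₂ t is reduced by t³ = 1 - (a + 3) t² - a t.
  t·_ : Element → Element
  t· (c₀ , c₁ , c₂) =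
    c₁ ⊕ scale -[1+ 0 ] ((a ⊕ (+ 3 ∷ [])) ⊗ c₀) , c₂ ⊕ scale -[1+ 0 ] (a ⊗ c₀) , c₀

  _⊠_ : Element → Element → Element
  c ⊠ (d₀ , d₁ , d₂) = d₀ · (t· (t· c)) ⊞ (d₁ · (t· c) ⊞ d₂ · c)

  -- Multiplication by 1 + 1/t has a nonnegative matrix on the basis t², t, 1,
  -- and 1 + 1/t exceeds its conjugates in absolute value.  By Perron–Frobenius
  -- every element positive at t acquires positive coefficients after enough
  -- multiplications, so that its sign is certified by finitely many integers.
  1+1/t : Element
  1+1/t = (+ 1 ∷ []) , a ⊕ (+ 3 ∷ []) , a ⊕ (+ 1 ∷ [])

  data Certified : ℕ → Element → Set where
    coefficients : ∀ {c₀ c₁ c₂} →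
      NonNegCoeffs c₀ → NonNegCoeffs c₁ → PosCoeffs c₂ → Certified 0 (c₀ , c₁ , c₂)
    multiply     : ∀ {k c} → Certified k (c ⊠ 1+1/t) → Certified (suc k) c

  -- Eight multiplications suffice for all elements met in the expansions below.
  Positive : Element → Set
  Positive = Certified 8

  Vanishes : Element → Set
  Vanishes (c₀ , c₁ , c₂) = ZeroCoeffs c₀ × ZeroCoeffs c₁ × ZeroCoeffs c₂

  -- (u₀ , u₁ , u₂) stands for the point (u₁ / u₀ , u₂ / u₀).
  State : Set
  State = Element × Element × Element

  Digit : Set
  Digit = Poly × Poly

  next : Digit → State → State
  next (d₁ , d₂) (u₀ , u₁ , u₂) = u₁ ⊟ d₁ · u₀ , u₂ ⊟ d₂ · u₀ , u₀

  -- Here vᵢ₋₁ = uᵢ - dᵢ u₀ for i = 1, 2, so after division by u₀ the four conditions say that both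
  -- fractional parts lie strictly between 0 and 1. The first also keeps the next denominator v₀
  -- positive.
  AreDigitsOf : Digit → State → Set
  AreDigitsOf d u@(u₀ , _) =
    let (v₀ , v₁ , _) = next d u
    in Positive v₀ × Positive v₁ × Positive (u₀ ⊟ v₀) × Positive (u₀ ⊟ v₁)

  AreExpansionOf : Digit → List Digit → State → Set
  AreExpansionOf d []       u = AreDigitsOf d u
  AreExpansionOf d (e ∷ ds) u = AreDigitsOf d u × AreExpansionOf e ds (next d u)

  run : Digit → List Digit → State → State
  run d []       u = next d u
  run d (e ∷ ds) u = run e ds (next d u)

  -- Equality of the two points after cross-multiplication, hence a finite check on coefficients
  -- that involves no division.
  Proportional : State → State → Set
  Proportional (u₀ , u₁ , u₂) (v₀ , v₁ , v₂) =
    Vanishes (u₁ ⊠ v₀ ⊟ v₁ ⊠ u₀) × Vanishes (u₂ ⊠ v₀ ⊟ v₂ ⊠ u₀)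

  -- The point (1 + t , (1 + t)²) = (-ρ′ , ρ′²).
  initial : State
  initial = ([] , [] , + 1 ∷ []) , ([] , + 1 ∷ [] , + 1 ∷ []) , (+ 1 ∷ [] , + 2 ∷ [] , + 1 ∷ [])

  IsPeriodicExpansion : List⁺ Digit → List⁺ Digit → Set
  IsPeriodicExpansion (d ∷ ds) (e ∷ es) =
    let u = run d ds initial
    in AreExpansionOf d ds initial × AreExpansionOf e es u × Proportional (run e es u) u

  -- Decidability of the certificates

  nonNegCoeffs? : ∀ p → Dec (NonNegCoeffs p)
  nonNegCoeffs? = All.all? (+ 0 ℤ.≤?_)

  zeroCoeffs? : ∀ p → Dec (ZeroCoeffs p)
  zeroCoeffs? = All.all? (+ 0 ℤ.≟_)

  posCoeffs? : ∀ p → Dec (PosCoeffs p)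
  posCoeffs? []      = no λ ()
  posCoeffs? (a ∷ p) = + 0 ℤ.<? a ×-dec nonNegCoeffs? p

  certified? : ∀ k c → Dec (Certified k c)
  certified? zero    (c₀ , c₁ , c₂) = map′
    (λ (0≤c₀ , 0≤c₁ , 0<c₂) → coefficients 0≤c₀ 0≤c₁ 0<c₂)
    (λ { (coefficients 0≤c₀ 0≤c₁ 0<c₂) → 0≤c₀ , 0≤c₁ , 0<c₂ })
    (nonNegCoeffs? c₀ ×-dec nonNegCoeffs? c₁ ×-dec posCoeffs? c₂)
  certified? (suc k) c = map′ multiply (λ { (multiply p) → p }) (certified? k (c ⊠ 1+1/t))

  vanishes? : ∀ c → Dec (Vanishes c)
  vanishes? (c₀ , c₁ , c₂) = zeroCoeffs? c₀ ×-dec zeroCoeffs? c₁ ×-dec zeroCoeffs? c₂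

  positive? : ∀ c → Dec (Positive c)
  positive? = certified? 8

  areDigitsOf? : ∀ d u → Dec (AreDigitsOf d u)
  areDigitsOf? d u@(u₀ , _) =
    let (v₀ , v₁ , _) = next d u
    in positive? v₀ ×-dec positive? v₁ ×-dec positive? (u₀ ⊟ v₀) ×-dec positive? (u₀ ⊟ v₁)

  areExpansionOf? : ∀ d ds u → Dec (AreExpansionOf d ds u)
  areExpansionOf? d []       u = areDigitsOf? d u
  areExpansionOf? d (e ∷ ds) u = areDigitsOf? d u ×-dec areExpansionOf? e ds (next d u)

  proportional? : ∀ u v → Dec (Proportional u v)
  proportional? (u₀ , u₁ , u₂) (v₀ , v₁ , v₂) =
    vanishes? (u₁ ⊠ v₀ ⊟ v₁ ⊠ u₀) ×-dec vanishes? (u₂ ⊠ v₀ ⊟ v₂ ⊠ u₀)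

  isPeriodicExpansion? : ∀ ds es → Dec (IsPeriodicExpansion ds es)
  isPeriodicExpansion? (d ∷ ds) (e ∷ es) =
    let u = run d ds initial
    in areExpansionOf? d ds initial ×-dec areExpansionOf? e es u ×-dec proportional? (run e es u) u

-- The expansion over an ordered field

-- The facts about the reals on which the expansion argument rests. The order enters through
-- positivity alone, reciprocals are taken of positive elements, and the integers enter by a ring
-- homomorphism so that they can be the coefficients of the ring solver.
record OrderedField : Set₁ where
  field
    commutativeRing : CommutativeRing 0ℓ 0ℓ
    homomorphism    : ℤ.+-*-rawRing -Raw-AlmostCommutative⟶ fromCommutativeRing commutativeRing

  open CommutativeRing commutativeRing public
    using (Carrier; _≈_; _+_; _*_; -_; _-_; setoid; +-cong; *-cong; -‿cong)
    renaming (refl to ≈-refl; sym to ≈-sym; trans to ≈-trans; reflexive to ≈-reflexive)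
  open _-Raw-AlmostCommutative⟶_ homomorphism public
    using () renaming (⟦_⟧ to fromℤ; +-homo to fromℤ-+; *-homo to fromℤ-*; -‿homo to fromℤ-neg)

  field
    Pos             : Carrier → Set
    pos-resp        : ∀ {x y} → x ≈ y → Pos x → Pos y
    pos-+           : ∀ {x y} → Pos x → Pos y → Pos (x + y)
    pos-*           : ∀ {x y} → Pos x → Pos y → Pos (x * y)
    pos-*-cancelˡ   : ∀ {x y} → Pos x → Pos (x * y) → Pos y
    pos-fromℤ       : ∀ n → Pos (fromℤ (+ suc n))
    reciprocal      : ∀ {x} → Pos x → ∃[ y ] (y * x ≈ fromℤ (+ 1))

  fromℤ-≟ : ∀ i j → Maybe (fromℤ i ≈ fromℤ j)
  fromℤ-≟ i j with i ℤ.≟ j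
  ... | yes refl = just ≈-refl
  ... | no  _    = nothing

  module Solver =
    RingSolver ℤ.+-*-rawRing (fromCommutativeRing commutativeRing) homomorphism fromℤ-≟

module Expansion (F : OrderedField) where

  open OrderedField F
  open SetoidReasoning setoid
  open Solver using (solve; _:=_; _:+_; _:*_; _:-_; :-_; con)

  Point : Set
  Point = Carrier × Carrier

  infix 4 _≈²_ _⟶_

  _≈²_ : Point → Point → Set
  (x₁ , x₂) ≈² (y₁ , y₂) = x₁ ≈ y₁ × x₂ ≈ y₂

  -- A step without an inverse operation: `eq₂` makes the second coordinate of y the reciprocal of
  -- the first fractional part, and `eq₁` multiplies by it. Stated so, the relation passes along
  -- equality of the target.
  record _⟶_ (x y : Point) : Set where
    field
      d₁ d₂  : ℤ
      lower₁ : Pos (proj₁ x - fromℤ d₁)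
      upper₁ : Pos (fromℤ d₁ + fromℤ (+ 1) - proj₁ x)
      lower₂ : Pos (proj₂ x - fromℤ d₂)
      upper₂ : Pos (fromℤ d₂ + fromℤ (+ 1) - proj₂ x)
      eq₁    : proj₁ y ≈ (proj₂ x - fromℤ d₂) * proj₂ y
      eq₂    : proj₂ y * (proj₁ x - fromℤ d₁) ≈ fromℤ (+ 1)

  open Orbits _⟶_ public

  *-congˡ : ∀ {x u v} → u ≈ v → x * u ≈ x * v
  *-congˡ = *-cong ≈-refl

  *-congʳ : ∀ {x u v} → u ≈ v → u * x ≈ v * x
  *-congʳ u≈v = *-cong u≈v ≈-refl

  minus-cong : ∀ {x y u v} → x ≈ y → u ≈ v → x - u ≈ y - v
  minus-cong x≈y u≈v = +-cong x≈y (-‿cong u≈v)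

  *-cancelʳ : ∀ {x y z} → Pos z → x * z ≈ y * z → x ≈ y
  *-cancelʳ {x} {y} {z} 0<z xz≈yz = begin
    x              ≈⟨ undo x ⟨
    x * z * z⁻¹    ≈⟨ *-congʳ xz≈yz ⟩
    y * z * z⁻¹    ≈⟨ undo y ⟩
    y              ∎
    where
    z⁻¹ : Carrier
    z⁻¹ = proj₁ (reciprocal 0<z)

    undo : ∀ w → w * z * z⁻¹ ≈ w
    undo w = begin
      w * z * z⁻¹      ≈⟨ solve 3 (λ w z r → w :* z :* r := w :* (r :* z)) ≈-refl w z z⁻¹ ⟩
      w * (z⁻¹ * z)    ≈⟨ *-congˡ (proj₂ (reciprocal 0<z)) ⟩
      w * fromℤ (+ 1)  ≈⟨ solve 1 (λ w → w :* con (+ 1) := w) ≈-refl w ⟩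
      w                ∎

  pos-*-cancelʳ : ∀ {x y} → Pos y → Pos (x * y) → Pos x
  pos-*-cancelʳ {x} {y} 0<y 0<xy =
    pos-*-cancelˡ 0<y (pos-resp (solve 2 (λ x y → x :* y := y :* x) ≈-refl x y) 0<xy)

  -- `Pos` is strict while i may be 0, so the summand y supplies the strictness.
  nonNeg-*-pos-+-pos : ∀ {i x y} → + 0 ℤ.≤ i → Pos x → Pos y → Pos (fromℤ i * x + y)
  nonNeg-*-pos-+-pos {+ zero} {x} {y} _ 0<x 0<y =
    pos-resp (solve 2 (λ x y → y := con (+ 0) :* x :+ y) ≈-refl x y) 0<y
  nonNeg-*-pos-+-pos {+ suc n} _ 0<x 0<y = pos-+ (pos-* (pos-fromℤ n) 0<x) 0<y

  pos-fromℤ′ : ∀ {i} → + 0 ℤ.< i → Pos (fromℤ i)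
  pos-fromℤ′ {+ suc n} _ = pos-fromℤ n
  pos-fromℤ′ {+ zero} (ℤ.+<+ ())

  -- This allows the last point of a period to be replaced by the first one, which it equals only up
  -- to `_≈²_`.
  ⟶-resp-≈² : ∀ {x y z} → y ≈² z → x ⟶ y → x ⟶ z
  ⟶-resp-≈² (y₁≈z₁ , y₂≈z₂) x⟶y = record
    { d₁ = d₁ ; d₂ = d₂ ; lower₁ = lower₁ ; upper₁ = upper₁ ; lower₂ = lower₂ ; upper₂ = upper₂
    ; eq₁ = ≈-trans (≈-sym y₁≈z₁) (≈-trans eq₁ (*-congˡ y₂≈z₂))
    ; eq₂ = ≈-trans (*-congʳ (≈-sym y₂≈z₂)) eq₂
    }
    where open _⟶_ x⟶y

  ⟶⁺-resp-≈² : ∀ {x y z} → y ≈² z → x ⟶⁺ y → x ⟶⁺ z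
  ⟶⁺-resp-≈² y≈z [ x⟶y ]   = [ ⟶-resp-≈² y≈z x⟶y ]
  ⟶⁺-resp-≈² y≈z (x⟶w ∷ p) = x⟶w ∷ ⟶⁺-resp-≈² y≈z p

  -- Evaluation of elements at the positive root t

  module Evaluation (a : Poly) (n : ℕ) (t : Carrier) (0<t : Pos t)
    (root : t * (t * t) + (fromℤ (eval a (+ n)) + fromℤ (+ 3)) * (t * t) + fromℤ (eval a (+ n)) * t
            ≈ fromℤ (+ 1))
    where

    open Order a

    ⟦_⟧ₚ : Poly → Carrier
    ⟦ p ⟧ₚ = fromℤ (eval p (+ n))

    ⟦⟧ₚ-⊕ : ∀ p q → ⟦ p ⊕ q ⟧ₚ ≈ ⟦ p ⟧ₚ + ⟦ q ⟧ₚ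
    ⟦⟧ₚ-⊕ p q = ≈-trans (≈-reflexive (cong fromℤ (eval-⊕ p q (+ n)))) (fromℤ-+ _ _)

    ⟦⟧ₚ-⊗ : ∀ p q → ⟦ p ⊗ q ⟧ₚ ≈ ⟦ p ⟧ₚ * ⟦ q ⟧ₚ
    ⟦⟧ₚ-⊗ p q = ≈-trans (≈-reflexive (cong fromℤ (eval-⊗ p q (+ n)))) (fromℤ-* _ _)

    ⟦⟧ₚ-scale : ∀ i p → ⟦ scale i p ⟧ₚ ≈ fromℤ i * ⟦ p ⟧ₚ
    ⟦⟧ₚ-scale i p = ≈-trans (≈-reflexive (cong fromℤ (eval-scale i p (+ n)))) (fromℤ-* _ _)

    ⟦⟧ₚ-const : ∀ i → ⟦ i ∷ [] ⟧ₚ ≈ fromℤ i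
    ⟦⟧ₚ-const i = ≈-reflexive (cong fromℤ
      (trans (cong (ℤ._+_ i) (ℤ.*-zeroʳ (+ n))) (ℤ.+-identityʳ i)))

    combine : Carrier → Carrier → Carrier → Carrier
    combine x₀ x₁ x₂ = x₀ * (t * t) + (x₁ * t + x₂)

    combine-cong : ∀ {x₀ x₁ x₂ y₀ y₁ y₂} → x₀ ≈ y₀ → x₁ ≈ y₁ → x₂ ≈ y₂ →
                   combine x₀ x₁ x₂ ≈ combine y₀ y₁ y₂
    combine-cong x₀≈y₀ x₁≈y₁ x₂≈y₂ = +-cong (*-congʳ x₀≈y₀) (+-cong (*-congʳ x₁≈y₁) x₂≈y₂)

    ⟦_⟧ : Element → Carrier
    ⟦ c₀ , c₁ , c₂ ⟧ = combine ⟦ c₀ ⟧ₚ ⟦ c₁ ⟧ₚ ⟦ c₂ ⟧ₚ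

    ⟦⟧-⊞ : ∀ c d → ⟦ c ⊞ d ⟧ ≈ ⟦ c ⟧ + ⟦ d ⟧
    ⟦⟧-⊞ (c₀ , c₁ , c₂) (d₀ , d₁ , d₂) = ≈-trans
      (combine-cong (⟦⟧ₚ-⊕ c₀ d₀) (⟦⟧ₚ-⊕ c₁ d₁) (⟦⟧ₚ-⊕ c₂ d₂))
      (solve 7 (λ t x₀ x₁ x₂ y₀ y₁ y₂ →
        (x₀ :+ y₀) :* (t :* t) :+ ((x₁ :+ y₁) :* t :+ (x₂ :+ y₂)) :=
        x₀ :* (t :* t) :+ (x₁ :* t :+ x₂) :+ (y₀ :* (t :* t) :+ (y₁ :* t :+ y₂))) ≈-refl
        t ⟦ c₀ ⟧ₚ ⟦ c₁ ⟧ₚ ⟦ c₂ ⟧ₚ ⟦ d₀ ⟧ₚ ⟦ d₁ ⟧ₚ ⟦ d₂ ⟧ₚ)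

    ⟦⟧-· : ∀ p c → ⟦ p · c ⟧ ≈ ⟦ p ⟧ₚ * ⟦ c ⟧
    ⟦⟧-· p (c₀ , c₁ , c₂) = ≈-trans
      (combine-cong (⟦⟧ₚ-⊗ p c₀) (⟦⟧ₚ-⊗ p c₁) (⟦⟧ₚ-⊗ p c₂))
      (solve 5 (λ t p x₀ x₁ x₂ →
        p :* x₀ :* (t :* t) :+ (p :* x₁ :* t :+ p :* x₂) :=
        p :* (x₀ :* (t :* t) :+ (x₁ :* t :+ x₂))) ≈-refl
        t ⟦ p ⟧ₚ ⟦ c₀ ⟧ₚ ⟦ c₁ ⟧ₚ ⟦ c₂ ⟧ₚ)

    ⟦⟧-⊟ : ∀ c d → ⟦ c ⊟ d ⟧ ≈ ⟦ c ⟧ - ⟦ d ⟧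
    ⟦⟧-⊟ c d = begin
      ⟦ c ⊟ d ⟧                                ≈⟨ ⟦⟧-⊞ c ((-[1+ 0 ] ∷ []) · d) ⟩
      ⟦ c ⟧ + ⟦ (-[1+ 0 ] ∷ []) · d ⟧          ≈⟨ +-cong ≈-refl (⟦⟧-· (-[1+ 0 ] ∷ []) d) ⟩
      ⟦ c ⟧ + ⟦ -[1+ 0 ] ∷ [] ⟧ₚ * ⟦ d ⟧       ≈⟨ +-cong ≈-refl (*-congʳ (⟦⟧ₚ-const -[1+ 0 ])) ⟩
      ⟦ c ⟧ + fromℤ -[1+ 0 ] * ⟦ d ⟧           ≈⟨ solve 2 (λ x y → x :+ con -[1+ 0 ] :* y := x :- y) ≈-refl ⟦ c ⟧ ⟦ d ⟧ ⟩
      ⟦ c ⟧ - ⟦ d ⟧                            ∎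

    ⟦⟧ₚ-a+ : ∀ i → ⟦ a ⊕ (i ∷ []) ⟧ₚ ≈ ⟦ a ⟧ₚ + fromℤ i
    ⟦⟧ₚ-a+ i = ≈-trans (⟦⟧ₚ-⊕ a (i ∷ [])) (+-cong ≈-refl (⟦⟧ₚ-const i))

    ⟦⟧ₚ-⊕-neg : ∀ p q r {α} → ⟦ q ⟧ₚ ≈ α →
                ⟦ p ⊕ scale -[1+ 0 ] (q ⊗ r) ⟧ₚ ≈ ⟦ p ⟧ₚ + fromℤ -[1+ 0 ] * (α * ⟦ r ⟧ₚ)
    ⟦⟧ₚ-⊕-neg p q r q≈α = ≈-trans (⟦⟧ₚ-⊕ p (scale -[1+ 0 ] (q ⊗ r)))
      (+-cong ≈-refl (≈-trans (⟦⟧ₚ-scale -[1+ 0 ] (q ⊗ r))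
        (*-congˡ (≈-trans (⟦⟧ₚ-⊗ q r) (*-congʳ q≈α)))))

    ⟦⟧-t· : ∀ c → ⟦ t· c ⟧ ≈ ⟦ c ⟧ * t
    ⟦⟧-t· (c₀ , c₁ , c₂) = begin
      ⟦ t· (c₀ , c₁ , c₂) ⟧
        ≈⟨ combine-cong (⟦⟧ₚ-⊕-neg c₁ (a ⊕ (+ 3 ∷ [])) c₀ (⟦⟧ₚ-a+ (+ 3)))
                        (⟦⟧ₚ-⊕-neg c₂ a c₀ ≈-refl) ≈-refl ⟩
      combine (x₁ + fromℤ -[1+ 0 ] * ((A + fromℤ (+ 3)) * x₀)) (x₂ + fromℤ -[1+ 0 ] * (A * x₀)) x₀
        -- As polynomials in t the two expressions differ by x₀ times 1 minus the cubic, which is 0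
        -- at the root.
        ≈⟨ solve 5 (λ t A x₀ x₁ x₂ →
             (x₁ :+ con -[1+ 0 ] :* ((A :+ con (+ 3)) :* x₀)) :* (t :* t)
               :+ ((x₂ :+ con -[1+ 0 ] :* (A :* x₀)) :* t :+ x₀) :=
             (x₀ :* (t :* t) :+ (x₁ :* t :+ x₂)) :* t
               :+ x₀ :* (con (+ 1) :- (t :* (t :* t) :+ (A :+ con (+ 3)) :* (t :* t) :+ A :* t)))
             ≈-refl t A x₀ x₁ x₂ ⟩
      combine x₀ x₁ x₂ * t
        + x₀ * (fromℤ (+ 1) - (t * (t * t) + (A + fromℤ (+ 3)) * (t * t) + A * t))
        ≈⟨ +-cong ≈-refl (*-congˡ (minus-cong ≈-refl root)) ⟩
      combine x₀ x₁ x₂ * t + x₀ * (fromℤ (+ 1) - fromℤ (+ 1))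
        ≈⟨ solve 2 (λ x y → x :+ y :* (con (+ 1) :- con (+ 1)) := x) ≈-refl (combine x₀ x₁ x₂ * t) x₀ ⟩
      combine x₀ x₁ x₂ * t ∎
      where
      A x₀ x₁ x₂ : Carrier
      A = ⟦ a ⟧ₚ
      x₀ = ⟦ c₀ ⟧ₚ
      x₁ = ⟦ c₁ ⟧ₚ
      x₂ = ⟦ c₂ ⟧ₚ

    ⟦⟧-⊠ : ∀ c d → ⟦ c ⊠ d ⟧ ≈ ⟦ c ⟧ * ⟦ d ⟧
    ⟦⟧-⊠ c (d₀ , d₁ , d₂) = begin
      ⟦ d₀ · (t· (t· c)) ⊞ (d₁ · (t· c) ⊞ d₂ · c) ⟧
        ≈⟨ ⟦⟧-⊞ (d₀ · (t· (t· c))) (d₁ · (t· c) ⊞ d₂ · c) ⟩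
      ⟦ d₀ · (t· (t· c)) ⟧ + ⟦ d₁ · (t· c) ⊞ d₂ · c ⟧
        ≈⟨ +-cong (≈-trans (⟦⟧-· d₀ (t· (t· c))) (*-congˡ (≈-trans (⟦⟧-t· (t· c)) (*-congʳ (⟦⟧-t· c)))))
             (≈-trans (⟦⟧-⊞ (d₁ · (t· c)) (d₂ · c))
               (+-cong (≈-trans (⟦⟧-· d₁ (t· c)) (*-congˡ (⟦⟧-t· c))) (⟦⟧-· d₂ c))) ⟩
      y₀ * (⟦ c ⟧ * t * t) + (y₁ * (⟦ c ⟧ * t) + y₂ * ⟦ c ⟧)
        ≈⟨ solve 5 (λ t c y₀ y₁ y₂ →
             y₀ :* (c :* t :* t) :+ (y₁ :* (c :* t) :+ y₂ :* c) :=
             c :* (y₀ :* (t :* t) :+ (y₁ :* t :+ y₂))) ≈-refl t ⟦ c ⟧ y₀ y₁ y₂ ⟩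
      ⟦ c ⟧ * ⟦ d₀ , d₁ , d₂ ⟧ ∎
      where
      y₀ y₁ y₂ : Carrier
      y₀ = ⟦ d₀ ⟧ₚ
      y₁ = ⟦ d₁ ⟧ₚ
      y₂ = ⟦ d₂ ⟧ₚ

    -- By the cubic equation its product with t is 1 + t, and the positive factor t cancels.
    1+1/t-pos : Pos ⟦ 1+1/t ⟧
    1+1/t-pos = pos-*-cancelˡ 0<t (pos-resp (≈-sym t*[1+1/t]≈1+t) (pos-+ (pos-fromℤ 0) 0<t))
      where
      A : Carrier
      A = ⟦ a ⟧ₚ
      t*[1+1/t]≈1+t : t * ⟦ 1+1/t ⟧ ≈ fromℤ (+ 1) + t
      t*[1+1/t]≈1+t = begin
        t * ⟦ 1+1/t ⟧
          ≈⟨ *-congˡ (combine-cong (⟦⟧ₚ-const (+ 1)) (⟦⟧ₚ-a+ (+ 3)) (⟦⟧ₚ-a+ (+ 1))) ⟩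
        t * combine (fromℤ (+ 1)) (A + fromℤ (+ 3)) (A + fromℤ (+ 1))
          ≈⟨ solve 2 (λ t A →
               t :* (con (+ 1) :* (t :* t) :+ ((A :+ con (+ 3)) :* t :+ (A :+ con (+ 1)))) :=
               t :* (t :* t) :+ (A :+ con (+ 3)) :* (t :* t) :+ A :* t :+ t) ≈-refl t A ⟩
        t * (t * t) + (A + fromℤ (+ 3)) * (t * t) + A * t + t
          ≈⟨ +-cong root ≈-refl ⟩
        fromℤ (+ 1) + t ∎

    -- Nonnegative multiples of t² and t plus a positive constant are positive; each multiplication
    -- is by the positive number 1 + 1/t and can be cancelled again.
    certified⇒pos : ∀ {k c} → Certified k c → Pos ⟦ c ⟧
    certified⇒pos (coefficients {c₂ = c₂} 0≤c₀ 0≤c₁ 0<c₂) =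
      nonNeg-*-pos-+-pos (eval-nonNeg n 0≤c₀) (pos-* 0<t 0<t)
        (nonNeg-*-pos-+-pos (eval-nonNeg n 0≤c₁) 0<t (pos-fromℤ′ (eval-pos c₂ n 0<c₂)))
    certified⇒pos (multiply {c = c} p) =
      pos-*-cancelʳ 1+1/t-pos (pos-resp (⟦⟧-⊠ c 1+1/t) (certified⇒pos p))

    vanishes⇒≈0 : ∀ {c} → Vanishes c → ⟦ c ⟧ ≈ fromℤ (+ 0)
    vanishes⇒≈0 (c₀≡0 , c₁≡0 , c₂≡0) = ≈-trans
      (combine-cong (zeroₚ c₀≡0) (zeroₚ c₁≡0) (zeroₚ c₂≡0))
      (solve 1 (λ t → con (+ 0) :* (t :* t) :+ (con (+ 0) :* t :+ con (+ 0)) := con (+ 0)) ≈-refl t)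
      where
      zeroₚ : ∀ {p} → ZeroCoeffs p → ⟦ p ⟧ₚ ≈ fromℤ (+ 0)
      zeroₚ p≡0 = ≈-reflexive (cong fromℤ (eval-zero (+ n) p≡0))

    -- The ratios are stated with the denominator cleared; its positivity carries signs back from
    -- elements to coordinates.
    record Represents (x : Point) (u : State) : Set where
      constructor represents
      field
        u₀-pos : Pos ⟦ proj₁ u ⟧
        ratio₁ : proj₁ x * ⟦ proj₁ u ⟧ ≈ ⟦ proj₁ (proj₂ u) ⟧
        ratio₂ : proj₂ x * ⟦ proj₁ u ⟧ ≈ ⟦ proj₂ (proj₂ u) ⟧

    subtract-digit : ∀ u₀ u₁ d {x} → x * ⟦ u₀ ⟧ ≈ ⟦ u₁ ⟧ → (x - ⟦ d ⟧ₚ) * ⟦ u₀ ⟧ ≈ ⟦ u₁ ⊟ d · u₀ ⟧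
    subtract-digit u₀ u₁ d {x} xu₀≈u₁ = begin
      (x - ⟦ d ⟧ₚ) * ⟦ u₀ ⟧          ≈⟨ solve 3 (λ x d u → (x :- d) :* u := x :* u :- d :* u) ≈-refl x ⟦ d ⟧ₚ ⟦ u₀ ⟧ ⟩
      x * ⟦ u₀ ⟧ - ⟦ d ⟧ₚ * ⟦ u₀ ⟧   ≈⟨ minus-cong xu₀≈u₁ (≈-sym (⟦⟧-· d u₀)) ⟩
      ⟦ u₁ ⟧ - ⟦ d · u₀ ⟧            ≈⟨ ⟦⟧-⊟ u₁ (d · u₀) ⟨
      ⟦ u₁ ⊟ d · u₀ ⟧                ∎

    floor-upper : ∀ u₀ v {x i} → Pos ⟦ u₀ ⟧ → (x - i) * ⟦ u₀ ⟧ ≈ ⟦ v ⟧ → Pos ⟦ u₀ ⊟ v ⟧ →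
                  Pos (i + fromℤ (+ 1) - x)
    floor-upper u₀ v {x} {i} 0<u₀ ≈v v<u₀ = pos-*-cancelʳ 0<u₀ (pos-resp (≈-sym (begin
      (i + fromℤ (+ 1) - x) * ⟦ u₀ ⟧
        ≈⟨ solve 3 (λ x i u → (i :+ con (+ 1) :- x) :* u := u :- (x :- i) :* u) ≈-refl x i ⟦ u₀ ⟧ ⟩
      ⟦ u₀ ⟧ - (x - i) * ⟦ u₀ ⟧       ≈⟨ minus-cong ≈-refl ≈v ⟩
      ⟦ u₀ ⟧ - ⟦ v ⟧                  ≈⟨ ⟦⟧-⊟ u₀ v ⟨
      ⟦ u₀ ⊟ v ⟧                      ∎)) v<u₀)

    -- The fractional parts times u₀ are v₀ and v₁, so the certified inequalities become floor
    -- bounds on cancelling u₀. The new point is built from the reciprocal of the first fractional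
    -- part, and multiplying it by v₀ gives back v₁ and u₀.
    digits⇒step : ∀ {x u d} → Represents x u → AreDigitsOf d u →
                  ∃[ y ] (x ⟶ y × Represents y (next d u))
    digits⇒step {x@(x₁ , x₂)} {u@(u₀ , u₁ , u₂)} {d₁ , d₂}
      (represents 0<u₀ x₁u₀≈u₁ x₂u₀≈u₂) (0<v₀ , 0<v₁ , v₀<u₀ , v₁<u₀) =
      (y₁ , y₂)
      , record
        { d₁ = eval d₁ (+ n)
        ; d₂ = eval d₂ (+ n)
        ; lower₁ = 0<z₁
        ; upper₁ = floor-upper u₀ (u₁ ⊟ d₁ · u₀) 0<u₀ z₁u₀≈v₀ (certified⇒pos v₀<u₀)
        ; lower₂ = pos-*-cancelʳ 0<u₀ (pos-resp (≈-sym z₂u₀≈v₁) (certified⇒pos 0<v₁))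
        ; upper₂ = floor-upper u₀ (u₂ ⊟ d₂ · u₀) 0<u₀ z₂u₀≈v₁ (certified⇒pos v₁<u₀)
        ; eq₁ = ≈-refl
        ; eq₂ = y₂z₁≈1
        }
      , represents (certified⇒pos 0<v₀) y₁v₀≈v₁ y₂v₀≈u₀
      where
      z₁ z₂ : Carrier
      z₁ = x₁ - ⟦ d₁ ⟧ₚ
      z₂ = x₂ - ⟦ d₂ ⟧ₚ

      z₁u₀≈v₀ : z₁ * ⟦ u₀ ⟧ ≈ ⟦ u₁ ⊟ d₁ · u₀ ⟧
      z₁u₀≈v₀ = subtract-digit u₀ u₁ d₁ x₁u₀≈u₁

      z₂u₀≈v₁ : z₂ * ⟦ u₀ ⟧ ≈ ⟦ u₂ ⊟ d₂ · u₀ ⟧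
      z₂u₀≈v₁ = subtract-digit u₀ u₂ d₂ x₂u₀≈u₂

      0<z₁ : Pos z₁
      0<z₁ = pos-*-cancelʳ 0<u₀ (pos-resp (≈-sym z₁u₀≈v₀) (certified⇒pos 0<v₀))

      y₁ y₂ : Carrier
      y₂ = proj₁ (reciprocal 0<z₁)
      y₁ = z₂ * y₂

      y₂z₁≈1 : y₂ * z₁ ≈ fromℤ (+ 1)
      y₂z₁≈1 = proj₂ (reciprocal 0<z₁)

      y₂v₀≈u₀ : y₂ * ⟦ u₁ ⊟ d₁ · u₀ ⟧ ≈ ⟦ u₀ ⟧
      y₂v₀≈u₀ = begin
        y₂ * ⟦ u₁ ⊟ d₁ · u₀ ⟧  ≈⟨ *-congˡ z₁u₀≈v₀ ⟨
        y₂ * (z₁ * ⟦ u₀ ⟧)     ≈⟨ solve 3 (λ y z u → y :* (z :* u) := y :* z :* u) ≈-refl y₂ z₁ ⟦ u₀ ⟧ ⟩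
        y₂ * z₁ * ⟦ u₀ ⟧       ≈⟨ *-congʳ y₂z₁≈1 ⟩
        fromℤ (+ 1) * ⟦ u₀ ⟧   ≈⟨ solve 1 (λ u → con (+ 1) :* u := u) ≈-refl ⟦ u₀ ⟧ ⟩
        ⟦ u₀ ⟧                 ∎

      y₁v₀≈v₁ : y₁ * ⟦ u₁ ⊟ d₁ · u₀ ⟧ ≈ ⟦ u₂ ⊟ d₂ · u₀ ⟧
      y₁v₀≈v₁ = begin
        z₂ * y₂ * ⟦ u₁ ⊟ d₁ · u₀ ⟧    ≈⟨ solve 3 (λ z y v → z :* y :* v := z :* (y :* v)) ≈-refl z₂ y₂ _ ⟩
        z₂ * (y₂ * ⟦ u₁ ⊟ d₁ · u₀ ⟧)  ≈⟨ *-congˡ y₂v₀≈u₀ ⟩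
        z₂ * ⟦ u₀ ⟧                   ≈⟨ z₂u₀≈v₁ ⟩
        ⟦ u₂ ⊟ d₂ · u₀ ⟧              ∎

    expansion⇒path : ∀ d ds {x u} → Represents x u → AreExpansionOf d ds u →
                     ∃[ y ] (x ⟶⁺ y × Represents y (run d ds u))
    expansion⇒path d [] {x} {u} x~u digits =
      let (y , x⟶y , y~) = digits⇒step {x} {u} {d} x~u digits in y , [ x⟶y ] , y~
    expansion⇒path d (e ∷ ds) {x} {u} x~u (digits , rest) =
      let (y , x⟶y , y~) = digits⇒step {x} {u} {d} x~u digits
          (z , y⟶⁺z , z~) = expansion⇒path e ds y~ rest
      in z , x⟶y ∷ y⟶⁺z , z~

    -- Multiplied by the positive number u₀ v₀, the difference x - y becomes u₁ v₀ - v₁ u₀, which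
    -- vanishes.
    proportional⇒≈ : ∀ {x y} u₀ u₁ v₀ v₁ → Pos ⟦ u₀ ⟧ → Pos ⟦ v₀ ⟧ →
      x * ⟦ u₀ ⟧ ≈ ⟦ u₁ ⟧ → y * ⟦ v₀ ⟧ ≈ ⟦ v₁ ⟧ → Vanishes (u₁ ⊠ v₀ ⊟ v₁ ⊠ u₀) → x ≈ y
    proportional⇒≈ {x} {y} u₀ u₁ v₀ v₁ 0<u₀ 0<v₀ xu₀≈u₁ yv₀≈v₁ vanishes =
      *-cancelʳ (pos-* 0<u₀ 0<v₀) (begin
        x * (U₀ * V₀)                  ≈⟨ solve 4 (λ x y u v → x :* (u :* v) := (x :* u :* v :- y :* v :* u) :+ y :* (u :* v)) ≈-refl x y U₀ V₀ ⟩
        (x * U₀ * V₀ - y * V₀ * U₀) + y * (U₀ * V₀)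
          ≈⟨ +-cong (minus-cong (*-congʳ xu₀≈u₁) (*-congʳ yv₀≈v₁)) ≈-refl ⟩
        (⟦ u₁ ⟧ * V₀ - ⟦ v₁ ⟧ * U₀) + y * (U₀ * V₀)
          ≈⟨ +-cong (minus-cong (⟦⟧-⊠ u₁ v₀) (⟦⟧-⊠ v₁ u₀)) ≈-refl ⟨
        (⟦ u₁ ⊠ v₀ ⟧ - ⟦ v₁ ⊠ u₀ ⟧) + y * (U₀ * V₀)
          ≈⟨ +-cong (⟦⟧-⊟ (u₁ ⊠ v₀) (v₁ ⊠ u₀)) ≈-refl ⟨
        ⟦ u₁ ⊠ v₀ ⊟ v₁ ⊠ u₀ ⟧ + y * (U₀ * V₀)
          ≈⟨ +-cong (vanishes⇒≈0 vanishes) ≈-refl ⟩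
        fromℤ (+ 0) + y * (U₀ * V₀)    ≈⟨ solve 1 (λ x → con (+ 0) :+ x := x) ≈-refl (y * (U₀ * V₀)) ⟩
        y * (U₀ * V₀)                  ∎)
      where
      U₀ V₀ : Carrier
      U₀ = ⟦ u₀ ⟧
      V₀ = ⟦ v₀ ⟧

    -- The starting point and the closing of the period

    1+t : Carrier
    1+t = fromℤ (+ 1) + t

    origin : Point
    origin = 1+t , 1+t * 1+t

    ⟦1⟧ : ⟦ [] , [] , + 1 ∷ [] ⟧ ≈ fromℤ (+ 1)
    ⟦1⟧ = ≈-trans (combine-cong ≈-refl ≈-refl (⟦⟧ₚ-const (+ 1)))
      (solve 1 (λ t → con (+ 0) :* (t :* t) :+ (con (+ 0) :* t :+ con (+ 1)) := con (+ 1)) ≈-refl t)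

    origin-represents-initial : Represents origin initial
    origin-represents-initial = represents (pos-resp (≈-sym ⟦1⟧) (pos-fromℤ 0))
      (begin
        1+t * ⟦ [] , [] , + 1 ∷ [] ⟧  ≈⟨ *-congˡ ⟦1⟧ ⟩
        1+t * fromℤ (+ 1)             ≈⟨ solve 1 (λ t → (con (+ 1) :+ t) :* con (+ 1) := con (+ 0) :* (t :* t) :+ (con (+ 1) :* t :+ con (+ 1))) ≈-refl t ⟩
        combine (fromℤ (+ 0)) (fromℤ (+ 1)) (fromℤ (+ 1))
          ≈⟨ combine-cong ≈-refl (⟦⟧ₚ-const (+ 1)) (⟦⟧ₚ-const (+ 1)) ⟨
        ⟦ [] , + 1 ∷ [] , + 1 ∷ [] ⟧ ∎)
      (begin
        1+t * 1+t * ⟦ [] , [] , + 1 ∷ [] ⟧  ≈⟨ *-congˡ ⟦1⟧ ⟩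
        1+t * 1+t * fromℤ (+ 1)       ≈⟨ solve 1 (λ t → (con (+ 1) :+ t) :* (con (+ 1) :+ t) :* con (+ 1) := con (+ 1) :* (t :* t) :+ (con (+ 2) :* t :+ con (+ 1))) ≈-refl t ⟩
        combine (fromℤ (+ 1)) (fromℤ (+ 2)) (fromℤ (+ 1))
          ≈⟨ combine-cong (⟦⟧ₚ-const (+ 1)) (⟦⟧ₚ-const (+ 2)) (⟦⟧ₚ-const (+ 1)) ⟨
        ⟦ + 1 ∷ [] , + 2 ∷ [] , + 1 ∷ [] ⟧ ∎)

    periodic : ∀ {ds es} → IsPeriodicExpansion ds es → HasPeriodicOrbit origin
    periodic {d ∷ ds} {e ∷ es} (preperiod , period , same₁ , same₂) =
      let u = run d ds initial
          (y , origin⟶⁺y , y~u) = expansion⇒path d ds origin-represents-initial preperiod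
          (z , y⟶⁺z , z~v) = expansion⇒path e es y~u period
          (represents 0<u₀ y₁u₀≈u₁ y₂u₀≈u₂) = y~u
          (represents 0<v₀ z₁v₀≈v₁ z₂v₀≈v₂) = z~v
          v = run e es u
          z≈y = proportional⇒≈ (proj₁ v) (proj₁ (proj₂ v)) (proj₁ u) (proj₁ (proj₂ u)) 0<v₀ 0<u₀ z₁v₀≈v₁ y₁u₀≈u₁ same₁
              , proportional⇒≈ (proj₁ v) (proj₂ (proj₂ v)) (proj₁ u) (proj₂ (proj₂ u)) 0<v₀ 0<u₀ z₂v₀≈v₂ y₂u₀≈u₂ same₂
      -- The period ends at z ≈ y; redirecting its last step to y itself yields a genuine cycle.
      in prepend-path origin⟶⁺y (cycle⇒periodic (⟶⁺-resp-≈² z≈y y⟶⁺z))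

  -- Powers are written with the final factor 1 left by the recursion of `_^_`, so that over the
  -- reals this agrees termwise with `shanks`.
  Shanks : ℤ → Carrier → Carrier
  Shanks a x = x * (x * (x * fromℤ (+ 1))) - fromℤ a * (x * (x * fromℤ (+ 1)))
    - fromℤ (a ℤ.+ + 3) * x - fromℤ (+ 1)

  shanks-periodic : ∀ (p : Poly) n r {ds es} → Shanks (eval p (+ n)) r ≈ fromℤ (+ 0) →
    Pos (- fromℤ (+ 1) - r) → Order.IsPeriodicExpansion p ds es →
    ∃[ x ] (x ≈² (- r , r * (r * fromℤ (+ 1))) × HasPeriodicOrbit x)
  shanks-periodic p n r root 0<t expansion =
    origin
    , ( solve 1 (λ r → con (+ 1) :+ (:- con (+ 1) :- r) := :- r) ≈-refl r
      , solve 1 (λ r → (con (+ 1) :+ (:- con (+ 1) :- r)) :* (con (+ 1) :+ (:- con (+ 1) :- r)) :=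
                       r :* (r :* con (+ 1))) ≈-refl r )
    , periodic expansion
    where
    a : ℤ
    a = eval p (+ n)

    t A : Carrier
    t = - fromℤ (+ 1) - r
    A = fromℤ a

    t-root : t * (t * t) + (A + fromℤ (+ 3)) * (t * t) + A * t ≈ fromℤ (+ 1)
    t-root = begin
      t * (t * t) + (A + fromℤ (+ 3)) * (t * t) + A * t
        -- Substituting t = -1 - r turns the left side into 1 minus the Shanks polynomial at r.
        ≈⟨ solve 2 (λ r A → let t = :- con (+ 1) :- r in
             t :* (t :* t) :+ (A :+ con (+ 3)) :* (t :* t) :+ A :* t :=
             con (+ 1) :- (r :* (r :* (r :* con (+ 1))) :- A :* (r :* (r :* con (+ 1)))
               :- (A :+ con (+ 3)) :* r :- con (+ 1))) ≈-refl r A ⟩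
      fromℤ (+ 1) - (r * (r * (r * fromℤ (+ 1))) - A * (r * (r * fromℤ (+ 1)))
        - (A + fromℤ (+ 3)) * r - fromℤ (+ 1))
        ≈⟨ minus-cong ≈-refl (minus-cong (minus-cong ≈-refl (*-congʳ (fromℤ-+ a (+ 3)))) ≈-refl) ⟨
      fromℤ (+ 1) - Shanks a r  ≈⟨ minus-cong ≈-refl root ⟩
      fromℤ (+ 1) - fromℤ (+ 0) ≈⟨ solve 0 (con (+ 1) :- con (+ 0) := con (+ 1)) ≈-refl ⟩
      fromℤ (+ 1) ∎

    open Evaluation p n t 0<t t-root

-- The digits of the expansions

-- The digits, found by computing examples, are polynomials in a parameter m with
-- a = -1, 0, 1, 2, 3, 4 + 2m or 5 + 2m: from 4 on they involve ⌊ a / 2 ⌋ and the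
-- parity of a.
record KnownExpansion (a : ℤ) : Set where
  constructor known
  field
    polynomial       : Poly
    parameter        : ℕ
    a≡               : eval polynomial (+ parameter) ≡ a
    preperiod period : List⁺ (Poly × Poly)
    valid            : True (Order.isPeriodicExpansion? polynomial preperiod period)

infix 8 ‵_ _+m*_

‵_ : ℕ → Poly
‵ i = + i ∷ []

_+m*_ : ℕ → ℕ → Poly
i +m* j = + i ∷ + j ∷ []

-- The value is put into the form remainder plus quotient times divisor that `divMod` returns.
eval-linear : ∀ i j n → eval (i +m* j) (+ n) ≡ + (i ℕ.+ n ℕ.* j)
eval-linear i j n = trans
  (solve 3 (λ i j m → i :+ m :* (j :+ m :* con (+ 0)) := i :+ m :* j) refl (+ i) (+ j) (+ n))
  (cong (ℤ._+_ (+ i)) (sym (ℤ.pos-* n j)))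
  where open ℤ-Solver

-- For a = 4 + k the parameter m is the quotient of k by 2 and the remainder selects the family.
-- Each final `_` is settled by evaluating the decision procedure; in the two families it runs on
-- polynomials in m, so one evaluation covers all m.
known-expansion : ∀ a → ℤ.- (+ 1) ℤ.≤ a → KnownExpansion a
known-expansion -[1+ zero ] _ = known (-[1+ 0 ] ∷ []) 0 refl
  ((‵ 1 , ‵ 3) ∷ [])
  ((‵ 0 , ‵ 1) ∷ (‵ 0 , ‵ 3) ∷ []) _
known-expansion -[1+ suc _ ] (ℤ.-≤- ())
known-expansion (+ 0) _ = known (‵ 0) 0 refl
  ((‵ 1 , ‵ 2) ∷ (‵ 0 , ‵ 1) ∷ [])
  ((‵ 1 , ‵ 1) ∷ (‵ 1 , ‵ 2) ∷ (‵ 1 , ‵ 1) ∷ []) _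
known-expansion (+ 1) _ = known (‵ 1) 0 refl
  ((‵ 1 , ‵ 1) ∷ (‵ 2 , ‵ 2) ∷ [])
  ((‵ 1 , ‵ 2) ∷ (‵ 0 , ‵ 1) ∷ (‵ 0 , ‵ 1) ∷ (‵ 0 , ‵ 2) ∷ (‵ 1 , ‵ 3) ∷ []) _
known-expansion (+ 2) _ = known (‵ 2) 0 refl
  ((‵ 1 , ‵ 1) ∷ (‵ 2 , ‵ 3) ∷ [])
  ((‵ 1 , ‵ 3) ∷ (‵ 0 , ‵ 1) ∷ (‵ 0 , ‵ 1) ∷ (‵ 1 , ‵ 2) ∷ (‵ 1 , ‵ 4) ∷ []) _
known-expansion (+ 3) _ = known (‵ 3) 0 refl
  ((‵ 1 , ‵ 1) ∷ (‵ 2 , ‵ 4) ∷ [])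
  ((‵ 1 , ‵ 4) ∷ (‵ 0 , ‵ 1) ∷ (‵ 0 , ‵ 1) ∷ (‵ 2 , ‵ 2) ∷ (‵ 1 , ‵ 5) ∷ []) _
known-expansion (+ suc (suc (suc (suc k)))) _ with k divMod 2
... | result m zero refl = known (4 +m* 2) m (eval-linear 4 2 m)
  ((‵ 1 , ‵ 1) ∷ (‵ 2 , 5 +m* 2) ∷ [])
  ((‵ 1 , 5 +m* 2) ∷ (‵ 0 , ‵ 1) ∷ (‵ 0 , 2 +m* 1) ∷ (‵ 0 , ‵ 2) ∷ (‵ 0 , ‵ 1)
    ∷ (0 +m* 1 , 5 +m* 1) ∷ (‵ 1 , 6 +m* 2) ∷ []) _
... | result m (suc zero) refl = known (5 +m* 2) m (eval-linear 5 2 m)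
  ((‵ 1 , ‵ 1) ∷ (‵ 2 , 6 +m* 2) ∷ [])
  ((‵ 1 , 6 +m* 2) ∷ (‵ 0 , ‵ 1) ∷ (‵ 0 , 2 +m* 1) ∷ (‵ 1 , ‵ 2) ∷ (‵ 0 , ‵ 1)
    ∷ (0 +m* 1 , 6 +m* 1) ∷ (‵ 1 , 7 +m* 2) ∷ []) _

open import Defs

-- Null sequences of rationals

Null Bounded : (ℕ → ℚ) → Set
Null s = ∀ ε → 0ℚ ℚ.< ε → ∃[ N ] (∀ n → N ℕ.≤ n → ∣ s n ∣ ℚ.< ε)
Bounded s = ∃[ B ] (0ℚ ℚ.< B × ∃[ N ] (∀ n → N ℕ.≤ n → ∣ s n ∣ ℚ.≤ B))

*-pos : ∀ {p q} → 0ℚ ℚ.< p → 0ℚ ℚ.< q → 0ℚ ℚ.< p ℚ.* q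
*-pos {p} {q} 0<p 0<q =
  subst (ℚ._< p ℚ.* q) (ℚ.*-zeroʳ p) (ℚ.*-monoʳ-<-pos p {{ℚ.positive 0<p}} 0<q)

½-pos : ∀ {ε} → 0ℚ ℚ.< ε → 0ℚ ℚ.< ½ ℚ.* ε
½-pos = *-pos (ℚ.positive⁻¹ ½)

½+½ : ∀ ε → ½ ℚ.* ε ℚ.+ ½ ℚ.* ε ≡ ε
½+½ ε = trans (sym (ℚ.*-distribʳ-+ ε ½ ½)) (ℚ.*-identityˡ ε)

divide : ∀ {d p} → 0ℚ ℚ.< d → 0ℚ ℚ.< p → ∃[ q ] (0ℚ ℚ.< q × d ℚ.* q ≡ p)
divide {d} {p} 0<d 0<p = 1/d ℚ.* p , *-pos 0<1/d 0<p ,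
  trans (sym (ℚ.*-assoc d 1/d p))
    (trans (cong (ℚ._* p) (ℚ.*-inverseʳ d)) (ℚ.*-identityˡ p))
  where
  instance
    d-nonZero : ℚ.NonZero d
    d-nonZero = ℚ.pos⇒nonZero d {{ℚ.positive 0<d}}
  1/d : ℚ
  1/d = ℚ.1/ d
  0<1/d : 0ℚ ℚ.< 1/d
  0<1/d = ℚ.positive⁻¹ 1/d {{ℚ.1/pos⇒pos d {{ℚ.positive 0<d}}}}

⊔ˡ : ∀ a b {n} → a ⊔ b ℕ.≤ n → a ℕ.≤ n
⊔ˡ a b = ℕ.≤-trans (ℕ.m≤m⊔n a b)

⊔ʳ : ∀ a b {n} → a ⊔ b ℕ.≤ n → b ℕ.≤ n
⊔ʳ a b = ℕ.≤-trans (ℕ.m≤n⊔m a b)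

null-resp : ∀ {s r} → (∀ n → s n ≡ r n) → Null s → Null r
null-resp s≡r s→0 ε 0<ε =
  let (N , s<ε) = s→0 ε 0<ε in N , λ n n≥ → subst (λ p → ∣ p ∣ ℚ.< ε) (s≡r n) (s<ε n n≥)

null-0 : Null (λ _ → 0ℚ)
null-0 ε 0<ε = 0 , λ _ _ → 0<ε

null-neg : ∀ {s} → Null s → Null (λ n → ℚ.- s n)
null-neg {s} s→0 ε 0<ε =
  let (N , s<ε) = s→0 ε 0<ε
  in N , λ n n≥ → subst (ℚ._< ε) (sym (ℚ.∣-p∣≡∣p∣ (s n))) (s<ε n n≥)

null-+ : ∀ {s r} → Null s → Null r → Null (λ n → s n ℚ.+ r n)
null-+ {s} {r} s→0 r→0 ε 0<ε =
  let (M , s<) = s→0 (½ ℚ.* ε) (½-pos 0<ε)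
      (N , r<) = r→0 (½ ℚ.* ε) (½-pos 0<ε)
  in M ⊔ N , λ n n≥ → begin-strict
    ∣ s n ℚ.+ r n ∣          ≤⟨ ℚ.∣p+q∣≤∣p∣+∣q∣ (s n) (r n) ⟩
    ∣ s n ∣ ℚ.+ ∣ r n ∣      <⟨ ℚ.+-mono-< (s< n (⊔ˡ M N n≥)) (r< n (⊔ʳ M N n≥)) ⟩
    ½ ℚ.* ε ℚ.+ ½ ℚ.* ε      ≡⟨ ½+½ ε ⟩
    ε                        ∎
  where open ℚ.≤-Reasoning

bounded-*-null : ∀ {b s} → Bounded b → Null s → Null (λ n → b n ℚ.* s n)
bounded-*-null {b} {s} (B , 0<B , M , b≤) s→0 ε 0<ε =
  let (η , 0<η , Bη≡ε) = divide 0<B 0<ε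
      (N , s<) = s→0 η 0<η
  in M ⊔ N , λ n n≥ → begin-strict
    ∣ b n ℚ.* s n ∣          ≡⟨ ℚ.∣p*q∣≡∣p∣*∣q∣ (b n) (s n) ⟩
    ∣ b n ∣ ℚ.* ∣ s n ∣      ≤⟨ ℚ.*-monoʳ-≤-nonNeg ∣ s n ∣ {{ℚ.∣-∣-nonNeg (s n)}} (b≤ n (⊔ˡ M N n≥)) ⟩
    B ℚ.* ∣ s n ∣            <⟨ ℚ.*-monoʳ-<-pos B {{ℚ.positive 0<B}} (s< n (⊔ʳ M N n≥)) ⟩
    B ℚ.* η                  ≡⟨ Bη≡ε ⟩
    ε                        ∎
  where open ℚ.≤-Reasoning

bounded : ∀ x → Bounded (seq x)
bounded x =
  let (N , close) = cauchy x 1ℚ (ℚ.positive⁻¹ 1ℚ)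
      c = seq x N
  in 1ℚ ℚ.+ ∣ c ∣ , ℚ.+-mono-<-≤ (ℚ.positive⁻¹ 1ℚ) (ℚ.0≤∣p∣ c) , N , λ n n≥ → begin
    ∣ seq x n ∣                      ≡⟨ cong ∣_∣ (cancel (seq x n) c) ⟨
    ∣ (seq x n ℚ.- c) ℚ.+ c ∣        ≤⟨ ℚ.∣p+q∣≤∣p∣+∣q∣ (seq x n ℚ.- c) c ⟩
    ∣ seq x n ℚ.- c ∣ ℚ.+ ∣ c ∣      ≤⟨ ℚ.+-monoˡ-≤ ∣ c ∣ (ℚ.<⇒≤ (close n N n≥ ℕ.≤-refl)) ⟩
    1ℚ ℚ.+ ∣ c ∣                     ∎
  where
  open ℚ.≤-Reasoning
  cancel : ∀ a b → (a ℚ.- b) ℚ.+ b ≡ a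
  cancel = solve 2 (λ a b → (a :- b) :+ b := a) refl
    where open +-*-Solver

-- The ring of real numbers

null-difference : ∀ {x y} → x ≃ y → Null (λ n → seq x n ℚ.- seq y n)
null-difference = _≃_.close

pointwise⇒≃ : ∀ {x y} → (∀ n → seq x n ≡ seq y n) → x ≃ y
pointwise⇒≃ {x} {y} x≡y = mk≃ (null-resp
  (λ n → sym (trans (cong (ℚ._- seq y n) (x≡y n)) (ℚ.+-inverseʳ (seq y n)))) null-0)

≃-refl : ∀ {x} → x ≃ x
≃-refl = pointwise⇒≃ λ _ → refl

≃-sym : ∀ {x y} → x ≃ y → y ≃ x
≃-sym {x} {y} x≃y =
  mk≃ (null-resp (λ n → swap (seq x n) (seq y n)) (null-neg (null-difference x≃y)))
  where
  swap : ∀ a b → ℚ.- (a ℚ.- b) ≡ b ℚ.- a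
  swap = solve 2 (λ a b → :- (a :- b) := b :- a) refl
    where open +-*-Solver

≃-trans : ∀ {x y z} → x ≃ y → y ≃ z → x ≃ z
≃-trans {x} {y} {z} x≃y y≃z = mk≃ (null-resp
  (λ n → telescope (seq x n) (seq y n) (seq z n))
  (null-+ (null-difference x≃y) (null-difference y≃z)))
  where
  telescope : ∀ a b c → (a ℚ.- b) ℚ.+ (b ℚ.- c) ≡ a ℚ.- c
  telescope = solve 3 (λ a b c → (a :- b) :+ (b :- c) := a :- c) refl
    where open +-*-Solver

+-cong : ∀ {x y u v} → x ≃ y → u ≃ v → x + u ≃ y + v
+-cong {x} {y} {u} {v} x≃y u≃v = mk≃ (null-resp
  (λ n → regroup (seq x n) (seq y n) (seq u n) (seq v n))
  (null-+ (null-difference x≃y) (null-difference u≃v)))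
  where
  regroup : ∀ a b c d → (a ℚ.- b) ℚ.+ (c ℚ.- d) ≡ (a ℚ.+ c) ℚ.- (b ℚ.+ d)
  regroup = solve 4 (λ a b c d → (a :- b) :+ (c :- d) := (a :+ c) :- (b :+ d)) refl
    where open +-*-Solver

neg-cong : ∀ {x y} → x ≃ y → - x ≃ - y
neg-cong {x} {y} x≃y = mk≃ (null-resp
  (λ n → regroup (seq x n) (seq y n)) (null-neg (null-difference x≃y)))
  where
  regroup : ∀ a b → ℚ.- (a ℚ.- b) ≡ (ℚ.- a) ℚ.- (ℚ.- b)
  regroup = solve 2 (λ a b → :- (a :- b) := (:- a) :- (:- b)) refl
    where open +-*-Solver

-- From x u - y v = x (u - v) + v (x - y), where each summand is a bounded sequence times a null
-- sequence.
*-cong : ∀ {x y u v} → x ≃ y → u ≃ v → x * u ≃ y * v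
*-cong {x} {y} {u} {v} x≃y u≃v = mk≃ (null-resp
  (λ n → regroup (seq x n) (seq y n) (seq u n) (seq v n))
  (null-+ (bounded-*-null (bounded x) (null-difference u≃v))
          (bounded-*-null (bounded v) (null-difference x≃y))))
  where
  regroup : ∀ a b c d → a ℚ.* (c ℚ.- d) ℚ.+ d ℚ.* (a ℚ.- b) ≡ a ℚ.* c ℚ.- b ℚ.* d
  regroup = solve 4 (λ a b c d → a :* (c :- d) :+ d :* (a :- b) := a :* c :- b :* d) refl
    where open +-*-Solver

ℝ-isCommutativeRing : IsCommutativeRing _≃_ _+_ _*_ -_ 0ℝ 1ℝ
ℝ-isCommutativeRing = record
  { isRing = record
    { +-isAbelianGroup = record
      { isGroup = record
        { isMonoid = record
          { isSemigroup = record
            { isMagma = record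
              { isEquivalence = record { refl = ≃-refl ; sym = ≃-sym ; trans = ≃-trans }
              ; ∙-cong = +-cong
              }
            ; assoc = λ x y z → pointwise⇒≃ λ n → ℚ.+-assoc (seq x n) (seq y n) (seq z n)
            }
          ; identity = (λ x → pointwise⇒≃ λ n → ℚ.+-identityˡ (seq x n))
                     , (λ x → pointwise⇒≃ λ n → ℚ.+-identityʳ (seq x n))
          }
        ; inverse = (λ x → pointwise⇒≃ λ n → ℚ.+-inverseˡ (seq x n))
                  , (λ x → pointwise⇒≃ λ n → ℚ.+-inverseʳ (seq x n))
        ; ⁻¹-cong = neg-cong
        }
      ; comm = λ x y → pointwise⇒≃ λ n → ℚ.+-comm (seq x n) (seq y n)
      }
    ; *-cong = *-cong
    ; *-assoc = λ x y z → pointwise⇒≃ λ n → ℚ.*-assoc (seq x n) (seq y n) (seq z n)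
    ; *-identity = (λ x → pointwise⇒≃ λ n → ℚ.*-identityˡ (seq x n))
                 , (λ x → pointwise⇒≃ λ n → ℚ.*-identityʳ (seq x n))
    ; distrib = (λ x y z → pointwise⇒≃ λ n → ℚ.*-distribˡ-+ (seq x n) (seq y n) (seq z n))
              , (λ x y z → pointwise⇒≃ λ n → ℚ.*-distribʳ-+ (seq x n) (seq y n) (seq z n))
    }
  ; *-comm = λ x y → pointwise⇒≃ λ n → ℚ.*-comm (seq x n) (seq y n)
  }

ℝ-commutativeRing : CommutativeRing 0ℓ 0ℓ
ℝ-commutativeRing = record { isCommutativeRing = ℝ-isCommutativeRing }

integral-unnormalised : ∀ i → toℚᵘ (i ℚ./ 1) ℚᵘ.≃ mkℚᵘ i 0
integral-unnormalised i = ℚ.toℚᵘ-fromℚᵘ (mkℚᵘ i 0)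

-- The comparison takes place in the unnormalised rationals, where no reduction to lowest terms
-- intervenes.
fromℤ-+ : ∀ i j → fromℤ (i ℤ.+ j) ≃ fromℤ i + fromℤ j
fromℤ-+ i j = pointwise⇒≃ λ _ → ℚ.toℚᵘ-injective (begin
  toℚᵘ ((i ℤ.+ j) ℚ./ 1)             ≈⟨ integral-unnormalised (i ℤ.+ j) ⟩
  mkℚᵘ (i ℤ.+ j) 0                   ≈⟨ *≡* (cong (ℤ._* + 1) (cong₂ ℤ._+_ (ℤ.*-identityʳ i) (ℤ.*-identityʳ j))) ⟨
  mkℚᵘ i 0 ℚᵘ.+ mkℚᵘ j 0             ≈⟨ ℚᵘ.+-cong (integral-unnormalised i) (integral-unnormalised j) ⟨
  toℚᵘ (i ℚ./ 1) ℚᵘ.+ toℚᵘ (j ℚ./ 1) ≈⟨ ℚ.toℚᵘ-homo-+ (i ℚ./ 1) (j ℚ./ 1) ⟨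
  toℚᵘ (i ℚ./ 1 ℚ.+ j ℚ./ 1)         ∎)
  where open ℚᵘ.≃-Reasoning

fromℤ-* : ∀ i j → fromℤ (i ℤ.* j) ≃ fromℤ i * fromℤ j
fromℤ-* i j = pointwise⇒≃ λ _ → ℚ.toℚᵘ-injective (begin
  toℚᵘ ((i ℤ.* j) ℚ./ 1)             ≈⟨ integral-unnormalised (i ℤ.* j) ⟩
  mkℚᵘ i 0 ℚᵘ.* mkℚᵘ j 0             ≈⟨ ℚᵘ.*-cong (integral-unnormalised i) (integral-unnormalised j) ⟨
  toℚᵘ (i ℚ./ 1) ℚᵘ.* toℚᵘ (j ℚ./ 1) ≈⟨ ℚ.toℚᵘ-homo-* (i ℚ./ 1) (j ℚ./ 1) ⟨
  toℚᵘ ((i ℚ./ 1) ℚ.* (j ℚ./ 1))     ∎)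
  where open ℚᵘ.≃-Reasoning

fromℤ-neg : ∀ i → fromℤ (ℤ.- i) ≃ - fromℤ i
fromℤ-neg i = pointwise⇒≃ λ _ → ℚ.toℚᵘ-injective (begin
  toℚᵘ ((ℤ.- i) ℚ./ 1)               ≈⟨ integral-unnormalised (ℤ.- i) ⟩
  ℚᵘ.- mkℚᵘ i 0                      ≈⟨ ℚᵘ.-‿cong (integral-unnormalised i) ⟨
  ℚᵘ.- toℚᵘ (i ℚ./ 1)                ≈⟨ ℚ.toℚᵘ-homo‿- (i ℚ./ 1) ⟨
  toℚᵘ (ℚ.- (i ℚ./ 1))               ∎)
  where open ℚᵘ.≃-Reasoning

fromℤ-homomorphism : ℤ.+-*-rawRing -Raw-AlmostCommutative⟶ fromCommutativeRing ℝ-commutativeRing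
fromℤ-homomorphism = record
  { ⟦_⟧    = fromℤ
  ; +-homo = fromℤ-+
  ; *-homo = fromℤ-*
  ; -‿homo = fromℤ-neg
  ; 0-homo = ≃-refl
  ; 1-homo = ≃-refl
  }

-- Positive real numbers

positive : ∀ {x} δ → 0ℚ ℚ.< δ → ∀ N → (∀ n → N ℕ.≤ n → δ ℚ.≤ seq x n) → 0ℝ < x
positive {x} δ 0<δ N δ≤x =
  mk< δ 0<δ N λ n n≥ → subst (ℚ._≤ seq x n) (sym (ℚ.+-identityˡ δ)) (δ≤x n n≥)

gap≤ : ∀ {x} (0<x : 0ℝ < x) → ∀ n → _<_.from 0<x ℕ.≤ n → _<_.gap 0<x ℚ.≤ seq x n
gap≤ {x} (mk< δ _ _ δ≤x) n n≥ = subst (ℚ._≤ seq x n) (ℚ.+-identityˡ δ) (δ≤x n n≥)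

p≤∣p∣ : ∀ p → p ℚ.≤ ∣ p ∣
p≤∣p∣ p with ℚ.≤-total 0ℚ p
... | inj₁ 0≤p = ℚ.≤-reflexive (sym (ℚ.0≤p⇒∣p∣≡p 0≤p))
... | inj₂ p≤0 = ℚ.≤-trans p≤0 (ℚ.0≤∣p∣ p)

-- Eventually x is at least δ and differs from y by less than δ/2, which leaves y the gap δ/2.
pos-resp-≃ : ∀ {x y} → x ≃ y → 0ℝ < x → 0ℝ < y
pos-resp-≃ {x} {y} x≃y 0<x@(mk< δ 0<δ M _) =
  let (N , x-y<½δ) = null-difference x≃y (½ ℚ.* δ) (½-pos 0<δ)
  in positive (½ ℚ.* δ) (½-pos 0<δ) (M ⊔ N) λ n n≥ →
    ℚ.≮⇒≥ λ y<½δ → ℚ.<-irrefl refl (begin-strict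
    δ                                   ≤⟨ gap≤ 0<x n (⊔ˡ M N n≥) ⟩
    seq x n                             ≡⟨ cancel (seq x n) (seq y n) ⟨
    seq y n ℚ.+ (seq x n ℚ.- seq y n)   ≤⟨ ℚ.+-monoʳ-≤ (seq y n) (p≤∣p∣ _) ⟩
    seq y n ℚ.+ ∣ seq x n ℚ.- seq y n ∣ <⟨ ℚ.+-mono-< y<½δ (x-y<½δ n (⊔ʳ M N n≥)) ⟩
    ½ ℚ.* δ ℚ.+ ½ ℚ.* δ                 ≡⟨ ½+½ δ ⟩
    δ                                   ∎)
  where
  open ℚ.≤-Reasoning
  cancel : ∀ a b → b ℚ.+ (a ℚ.- b) ≡ a
  cancel = solve 2 (λ a b → b :+ (a :- b) := a) refl
    where open +-*-Solver

pos-+-pos : ∀ {x y} → 0ℝ < x → 0ℝ < y → 0ℝ < x + y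
pos-+-pos 0<x@(mk< δ 0<δ M _) 0<y@(mk< η 0<η N _) =
  positive (δ ℚ.+ η) (ℚ.+-mono-< 0<δ 0<η) (M ⊔ N) λ n n≥ →
    ℚ.+-mono-≤ (gap≤ 0<x n (⊔ˡ M N n≥)) (gap≤ 0<y n (⊔ʳ M N n≥))

pos-*-pos : ∀ {x y} → 0ℝ < x → 0ℝ < y → 0ℝ < x * y
pos-*-pos {x} {y} 0<x@(mk< δ 0<δ M _) 0<y@(mk< η 0<η N _) =
  positive (δ ℚ.* η) (*-pos 0<δ 0<η) (M ⊔ N) λ n n≥ → begin
    δ ℚ.* η               ≤⟨ ℚ.*-monoˡ-≤-nonNeg δ {{ℚ.nonNegative (ℚ.<⇒≤ 0<δ)}} (gap≤ 0<y n (⊔ʳ M N n≥)) ⟩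
    δ ℚ.* seq y n         ≤⟨ ℚ.*-monoʳ-≤-nonNeg (seq y n)
                               {{ℚ.nonNegative (ℚ.≤-trans (ℚ.<⇒≤ 0<η) (gap≤ 0<y n (⊔ʳ M N n≥)))}}
                               (gap≤ 0<x n (⊔ˡ M N n≥)) ⟩
    seq x n ℚ.* seq y n   ∎
  where open ℚ.≤-Reasoning

-- If eventually x is at most B and x y at least δ, then y is at least η = δ/B: a smaller term of y
-- would push the product below B η = δ.
pos-*-cancelˡ : ∀ {x y} → 0ℝ < x → 0ℝ < x * y → 0ℝ < y
pos-*-cancelˡ {x} {y} 0<x@(mk< γ 0<γ L _) 0<xy@(mk< δ 0<δ M _) =
  let (B , 0<B , N , x≤B) = bounded x
      (η , 0<η , Bη≡δ) = divide 0<B 0<δ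
  in positive η 0<η (L ⊔ (M ⊔ N)) λ n n≥ → ℚ.≮⇒≥ λ y<η →
    let n≥M⊔N = ⊔ʳ L (M ⊔ N) n≥
        0<xₙ = ℚ.<-≤-trans 0<γ (gap≤ 0<x n (⊔ˡ L (M ⊔ N) n≥))
    in ℚ.<-irrefl refl (begin-strict
      δ                     ≤⟨ gap≤ 0<xy n (⊔ˡ M N n≥M⊔N) ⟩
      seq x n ℚ.* seq y n   <⟨ ℚ.*-monoʳ-<-pos (seq x n) {{ℚ.positive 0<xₙ}} y<η ⟩
      seq x n ℚ.* η         ≤⟨ ℚ.*-monoʳ-≤-nonNeg η {{ℚ.nonNegative (ℚ.<⇒≤ 0<η)}}
                                 (ℚ.≤-trans (p≤∣p∣ _) (x≤B n (⊔ʳ M N n≥M⊔N))) ⟩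
      B ℚ.* η               ≡⟨ Bη≡δ ⟩
      δ                     ∎)
  where open ℚ.≤-Reasoning

0<y-x⇒x<y : ∀ {x y} → 0ℝ < y - x → x < y
0<y-x⇒x<y {x} {y} 0<y-x@(mk< δ 0<δ N _) = mk< δ 0<δ N λ n n≥ → begin
  seq x n ℚ.+ δ                     ≤⟨ ℚ.+-monoʳ-≤ (seq x n) (gap≤ 0<y-x n n≥) ⟩
  seq x n ℚ.+ (seq y n ℚ.- seq x n) ≡⟨ cancel (seq y n) (seq x n) ⟩
  seq y n                           ∎
  where
  open ℚ.≤-Reasoning
  cancel : ∀ a b → b ℚ.+ (a ℚ.- b) ≡ a
  cancel = solve 2 (λ a b → b :+ (a :- b) := a) refl
    where open +-*-Solver

x<y⇒0<y-x : ∀ {x y} → x < y → 0ℝ < y - x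
x<y⇒0<y-x {x} {y} (mk< δ 0<δ N x+δ≤y) = positive δ 0<δ N λ n n≥ → begin
  δ                                   ≡⟨ cancel (seq x n) δ ⟨
  (seq x n ℚ.+ δ) ℚ.- seq x n         ≤⟨ ℚ.+-monoˡ-≤ (ℚ.- seq x n) (x+δ≤y n n≥) ⟩
  seq y n ℚ.- seq x n                 ∎
  where
  open ℚ.≤-Reasoning
  cancel : ∀ a b → (a ℚ.+ b) ℚ.- a ≡ b
  cancel = solve 2 (λ a b → (a :+ b) :- a := b) refl
    where open +-*-Solver

<-asym : ∀ {x y} → x < y → ¬ y < x
<-asym {x} {y} (mk< δ 0<δ M x+δ≤y) (mk< η 0<η N y+η≤x) =
  let n = M ⊔ N
  in ℚ.<-irrefl refl (begin-strict
    seq x n               ≡⟨ ℚ.+-identityʳ (seq x n) ⟨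
    seq x n ℚ.+ 0ℚ        <⟨ ℚ.+-monoʳ-< (seq x n) 0<δ ⟩
    seq x n ℚ.+ δ         ≤⟨ x+δ≤y n (ℕ.m≤m⊔n M N) ⟩
    seq y n               ≡⟨ ℚ.+-identityʳ (seq y n) ⟨
    seq y n ℚ.+ 0ℚ        <⟨ ℚ.+-monoʳ-< (seq y n) 0<η ⟩
    seq y n ℚ.+ η         ≤⟨ y+η≤x n (ℕ.m≤n⊔m M N) ⟩
    seq x n               ∎)
  where open ℚ.≤-Reasoning

fromℤ-pos : ∀ n → 0ℝ < fromℤ (+ suc n)
fromℤ-pos n = positive _ (ℚ.positive⁻¹ _ {{ℚ.normalize-pos (suc n) 1}}) 0 λ _ _ → ℚ.≤-refl

-- inverse shifts the sequence of x by N, hence x is compared with its own shift.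
inverse-* : ∀ x (0<x : 0ℝ < x) → inverse x (inj₂ 0<x) * x ≃ 1ℝ
inverse-* x 0<x@(mk< δ 0<δ N δ≤x) = mk≃ (null-resp
  (λ n → trans (regroup (seq r n) (seq x n) (seq x (N ℕ.+ n)))
           (cong (λ p → seq r n ℚ.* seq x n ℚ.- p) (shifted-inverse n)))
  (bounded-*-null (bounded r) shift))
  where
  r : ℝ
  r = inverse x (inj₂ 0<x)

  shifted-nonZero : ∀ n → ℚ.NonZero (seq x (N ℕ.+ n))
  shifted-nonZero n = ℚ.pos⇒nonZero (seq x (N ℕ.+ n))
    {{ℚ.positive (ℚ.<-≤-trans 0<δ (gap≤ 0<x (N ℕ.+ n) (ℕ.m≤m+n N n)))}}

  shifted-inverse : ∀ n → seq r n ℚ.* seq x (N ℕ.+ n) ≡ 1ℚ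
  shifted-inverse n = ℚ.*-inverseˡ (seq x (N ℕ.+ n)) {{shifted-nonZero n}}

  shift : Null (λ n → seq x n ℚ.- seq x (N ℕ.+ n))
  shift ε 0<ε =
    let (M , close) = cauchy x ε 0<ε
    in M , λ n n≥ → close n (N ℕ.+ n) n≥ (ℕ.≤-trans n≥ (ℕ.m≤n+m n N))

  regroup : ∀ a b c → a ℚ.* (b ℚ.- c) ≡ a ℚ.* b ℚ.- a ℚ.* c
  regroup = solve 3 (λ a b c → a :* (b :- c) := a :* b :- a :* c) refl
    where open +-*-Solver

-- The Jacobi-Perron expansion over the reals

ℝ-orderedField : OrderedField
ℝ-orderedField = record
  { commutativeRing = ℝ-commutativeRing
  ; homomorphism    = fromℤ-homomorphism
  ; Pos             = 0ℝ <_
  ; pos-resp        = λ {x} {y} → pos-resp-≃ {x} {y}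
  ; pos-+           = λ {x} {y} → pos-+-pos {x} {y}
  ; pos-*           = λ {x} {y} → pos-*-pos {x} {y}
  ; pos-*-cancelˡ   = λ {x} {y} → pos-*-cancelˡ {x} {y}
  ; pos-fromℤ       = fromℤ-pos
  ; reciprocal      = λ {x} 0<x → inverse x (inj₂ 0<x) , inverse-* x 0<x
  }

open Expansion ℝ-orderedField using (_⟶_; *-cancelʳ; HasPeriodicOrbit; shanks-periodic)

-- ℝ-orderedField and Defs write the same numbers with operations that agree termwise;
-- these two lemmas translate between them.
pos-resp-seq : ∀ {x y} → 0ℝ < x → (∀ n → seq x n ≡ seq y n) → 0ℝ < y
pos-resp-seq {x} {y} 0<x x≡y = pos-resp-≃ {x} {y} (pointwise⇒≃ {x} {y} x≡y) 0<x

≃-resp-seq : ∀ {x x′ y y′} → x ≃ y →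
  (∀ n → seq x n ≡ seq x′ n) → (∀ n → seq y n ≡ seq y′ n) → x′ ≃ y′
≃-resp-seq {x} {x′} {y} {y′} x≃y x≡x′ y≡y′ =
  ≃-trans {x′} {x} {y′} (≃-sym {x} {x′} (pointwise⇒≃ {x} {x′} x≡x′))
    (≃-trans {x} {y} {y′} x≃y (pointwise⇒≃ {y} {y′} y≡y′))

*-cancelʳ-≃ : ∀ {x y z} → 0ℝ < z → x * z ≃ y * z → x ≃ y
*-cancelʳ-≃ {x} {y} {z} 0<z xz≃yz =
  *-cancelʳ {x} {y} {z} 0<z (≃-resp-seq xz≃yz (λ _ → refl) (λ _ → refl))

inverse-unique : ∀ {x y z} → 0ℝ < z → x * z ≃ 1ℝ → y * z ≃ 1ℝ → x ≃ y
inverse-unique {x} {y} {z} 0<z xz≃1 yz≃1 = *-cancelʳ-≃ {x} {y} {z} 0<z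
  (≃-trans {x * z} {1ℝ} {y * z} xz≃1 (≃-sym {y * z} {1ℝ} yz≃1))

-- Uniqueness of reciprocals identifies y₂ with `inverse`, formed with positivity as the witness of
-- apartness. The lower floor bounds are negated inequalities and follow from the strict ones by
-- asymmetry.
ijpaStep : ∀ x₁ x₂ y₁ y₂ d₁ d₂ →
  (0<z₁ : 0ℝ < x₁ - fromℤ d₁) → 0ℝ < fromℤ d₁ + 1ℝ - x₁ →
  0ℝ < x₂ - fromℤ d₂ → 0ℝ < fromℤ d₂ + 1ℝ - x₂ →
  y₁ ≃ (x₂ - fromℤ d₂) * y₂ → y₂ * (x₁ - fromℤ d₁) ≃ 1ℝ → IJPAStep (x₁ , x₂) (y₁ , y₂)
ijpaStep x₁ x₂ y₁ y₂ d₁ d₂ 0<z₁ z₁<1 0<z₂ z₂<1 y₁≃z₂y₂ y₂z₁≃1 =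
  d₁ , d₂
  , ( <-asym {fromℤ d₁} {x₁} (0<y-x⇒x<y {fromℤ d₁} {x₁} 0<z₁)
    , 0<y-x⇒x<y {x₁} {fromℤ d₁ + 1ℝ} z₁<1 )
  , ( <-asym {fromℤ d₂} {x₂} (0<y-x⇒x<y {fromℤ d₂} {x₂} 0<z₂)
    , 0<y-x⇒x<y {x₂} {fromℤ d₂ + 1ℝ} z₂<1 )
  , inj₂ 0<z₁
  , ≃-trans {y₁} {(x₂ - fromℤ d₂) * y₂} {(x₂ - fromℤ d₂) * inverse (x₁ - fromℤ d₁) (inj₂ 0<z₁)}
      y₁≃z₂y₂
      (*-cong {x₂ - fromℤ d₂} {x₂ - fromℤ d₂} {y₂} {inverse (x₁ - fromℤ d₁) (inj₂ 0<z₁)}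
        (≃-refl {x₂ - fromℤ d₂}) y₂≃)
  , y₂≃
  where
  y₂≃ : y₂ ≃ inverse (x₁ - fromℤ d₁) (inj₂ 0<z₁)
  y₂≃ = inverse-unique {y₂} {inverse (x₁ - fromℤ d₁) (inj₂ 0<z₁)} {x₁ - fromℤ d₁} 0<z₁ y₂z₁≃1
    (inverse-* (x₁ - fromℤ d₁) 0<z₁)

⟶⇒IJPAStep : ∀ {x y} → x ⟶ y → IJPAStep x y
⟶⇒IJPAStep {x₁ , x₂} {y₁ , y₂} x⟶y = ijpaStep x₁ x₂ y₁ y₂ d₁ d₂
  (pos-resp-seq lower₁ λ _ → refl) (pos-resp-seq upper₁ λ _ → refl)
  (pos-resp-seq lower₂ λ _ → refl) (pos-resp-seq upper₂ λ _ → refl)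
  (≃-resp-seq eq₁ (λ _ → refl) (λ _ → refl)) (≃-resp-seq eq₂ (λ _ → refl) (λ _ → refl))
  where open Expansion._⟶_ x⟶y

orbit⇒expansion : ∀ {x v} → x ≃² v → HasPeriodicOrbit x → HasPeriodicIJPAExpansion v
orbit⇒expansion {x} {v} x≃v (α , α₀≡x , steps , l₀ , l₁ , 1≤l₁ , repeats) =
  α , (subst (_≃² v) (sym α₀≡x) x≃v , λ k → ⟶⇒IJPAStep (steps k))
  , l₀ , l₁ , 1≤l₁ , λ k l₀≤k → subst (_≃² α k) (sym (repeats k l₀≤k)) (≃-refl , ≃-refl)

known⇒periodic : ∀ {a} → KnownExpansion a → ∀ ρ′ → shanks a ρ′ ≃ 0ℝ →
  ρ′ < - fromℤ (+ 1) → HasPeriodicIJPAExpansion (- ρ′ , ρ′ ^ 2)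
known⇒periodic (known p n refl ds es valid) ρ′ root ρ′<-1 =
  let (x , (x₁≃ , x₂≃) , periodic) = shanks-periodic p n ρ′
        (≃-resp-seq root (λ _ → refl) (λ _ → refl))
        -- This is 0 < t for t = -1 - ρ′.
        (pos-resp-seq (x<y⇒0<y-x {ρ′} { - fromℤ (+ 1)} ρ′<-1) (λ _ → refl))
        (toWitness {a? = Order.isPeriodicExpansion? p ds es} valid)
  in orbit⇒expansion
       ( ≃-resp-seq {x′ = proj₁ x} {y′ = - ρ′} x₁≃ (λ _ → refl) (λ _ → refl)
       , ≃-resp-seq {x′ = proj₂ x} {y′ = ρ′ ^ 2} x₂≃ (λ _ → refl) (λ _ → refl) )
       periodic

proposition6p2 : (a : ℤ) → (ℤ.- (+ 1)) ℤ.≤ a → (ρ′ : ℝ) → shanks a ρ′ ≃ 0ℝ →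
    - fromℤ (+ 2) < ρ′ → ρ′ < - fromℤ (+ 1) →
    HasPeriodicIJPAExpansion (- ρ′ , ρ′ ^ 2)
proposition6p2 a -1≤a ρ′ root _ ρ′<-1 = known⇒periodic (known-expansion a -1≤a) ρ′ root ρ′<-1
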